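{- The problems $k$-CONNECTED DOMINATING SET and $k$-DOMINATING CLIQUE, restricted to unit 3-track interval graphs, are both W[1]-hard with parameter $k$.
   Context: A dominating set of a graph $H$ is a set $D$ of vertices such that every vertex of $H$ is in $D$ or adjacent to a vertex of $D$. A connected dominating set is a dominating set $D$ such that the subgraph induced by $D$ is connected. A dominating clique is a set that is both a dominating set and a clique. $k$-CONNECTED DOMINATING SET (resp. $k$-DOMINATING CLIQUE): given a graph $H$ and an integer $k$, decide whether $H$ has a connected dominating set (resp. dominating clique) of $k$ vertices. The intersection graph of a family of sets has one vertex per member, two different members being adjacent iff they intersect; the family is a representation of the graph. A 3-track interval is the union of three intervals on three disjoint parallel lines (tracks), one interval on each track. A unit 3-track interval graph is the intersection graph of a family of 3-track intervals in which all intervals have unit length. Such a representation of $H$ is given as part of the input. A parameterized problem is W[1]-hard if every problem in W[1] has an FPT reduction to it; equivalently, if $k$-CLIQUE in general graphs (parameter $k$) has an FPT reduction to it. An FPT reduction maps an instance $(x,k)$ to an equivalent instance $(x',k')$ in time $g(k)\cdot|x|^{O(1)}$ with $k'\le h(k)$, for computable functions $g,h$. -}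

module Defs where

open import Data.Bool.Base using (Bool; true; false; if_then_else_)
open import Data.Fin.Base using (Fin)
open import Data.Fin.Subset using (Subset; _∈_; ∣_∣)
open import Data.Integer.Base using (ℤ; +_; -[1+_])
open import Data.Nat.Base using (ℕ; zero; suc; _+_; _*_; _^_; _≤_; _≡ᵇ_)
open import Data.Nat.Binary.Base as ℕᵇ using (ℕᵇ; 2[1+_]; 1+[2_])
open import Data.Product.Base using (∃-syntax; _×_; _,_)
open import Data.Rational.Unnormalised.Base as ℚᵘ using (ℚᵘ; ↥_; ↧ₙ_; 1ℚᵘ)
open import Data.Sum.Base using (_⊎_)
open import Data.Vec.Base using (Vec; []; _∷_; lookup; tabulate)
open import Function.Base using (_∘_; case_of_)
open import Function.Bundles using (_⇔_)
open import Level using (0ℓ)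
open import Relation.Binary.Core using (Rel)
open import Relation.Binary.Construct.Closure.ReflexiveTransitive using (Star)
open import Relation.Binary.Definitions
  using (Symmetric; Irreflexive)
open import Relation.Binary.PropositionalEquality.Core
  using (_≡_; _≢_; refl; sym; trans)
open import Relation.Unary using (Pred; _≬_)

------------------------------------------------------------------------
-- Computation

-- The machine model is the WHILE language over binary trees of
-- N. D. Jones, "Computability and Complexity from a Programming
-- Perspective".  It is Turing complete.  Every evaluation of an
-- expression is charged the sizes of all the trees occurring as values
-- of its subexpressions, not merely one unit per operation.  Hence a
-- tree built within time t from an input of size n has size at most
-- t + n, and a Turing machine simulates a run with polynomial overhead
-- (and conversely).

data Tree : Set where
  nil : Tree
  _∙_ : Tree → Tree → Tree

infixr 5 _∙_

size : Tree → ℕ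
size nil     = 1
size (l ∙ r) = 1 + size l + size r

data Expr : Set where
  var   : ℕ → Expr
  nil   : Expr
  cons  : Expr → Expr → Expr
  hd tl : Expr → Expr

data Command : Set where
  _≔_            : ℕ → Expr → Command
  _⨾_            : Command → Command → Command
  if′_then_else_ : Expr → Command → Command → Command
  while_repeat_  : Expr → Command → Command

infixr 3 _⨾_
infix  4 _≔_

Store : Set
Store = ℕ → Tree

_[_↦_] : Store → ℕ → Tree → Store
(σ [ x ↦ v ]) y = if x ≡ᵇ y then v else σ y

left right : Tree → Tree
left nil      = nil
left (l ∙ r)  = l
right nil     = nil
right (l ∙ r) = r

eval : Store → Expr → Tree
eval σ (var x)    = σ x
eval σ nil        = nil
eval σ (cons d e) = eval σ d ∙ eval σ e
eval σ (hd e)     = left (eval σ e)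
eval σ (tl e)     = right (eval σ e)

cost : Store → Expr → ℕ
cost σ (var x)    = size (σ x)
cost σ nil        = 1
cost σ (cons d e) = cost σ d + cost σ e + size (eval σ (cons d e))
cost σ (hd e)     = cost σ e + size (eval σ (hd e))
cost σ (tl e)     = cost σ e + size (eval σ (tl e))

-- σ ⊢ c ⇓ τ [ t ]: started in store σ, the command c terminates in
-- store τ after time t.  The tree nil is false, all others are true.

data _⊢_⇓_[_] (σ : Store) : Command → Store → ℕ → Set where

  assign  : ∀ {x e} → σ ⊢ x ≔ e ⇓ σ [ x ↦ eval σ e ] [ cost σ e ]

  seq     : ∀ {c d τ υ s t} →
            σ ⊢ c ⇓ τ [ s ] → τ ⊢ d ⇓ υ [ t ] →
            σ ⊢ c ⨾ d ⇓ υ [ s + t ]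

  ifTrue  : ∀ {e c d l r τ t} →
            eval σ e ≡ l ∙ r → σ ⊢ c ⇓ τ [ t ] →
            σ ⊢ if′ e then c else d ⇓ τ [ cost σ e + t ]

  ifFalse : ∀ {e c d τ t} →
            eval σ e ≡ nil → σ ⊢ d ⇓ τ [ t ] →
            σ ⊢ if′ e then c else d ⇓ τ [ cost σ e + t ]

  stop    : ∀ {e c} →
            eval σ e ≡ nil →
            σ ⊢ while e repeat c ⇓ σ [ cost σ e ]

  loop    : ∀ {e c l r τ υ s t} →
            eval σ e ≡ l ∙ r →
            σ ⊢ c ⇓ τ [ s ] → τ ⊢ while e repeat c ⇓ υ [ t ] →
            σ ⊢ while e repeat c ⇓ υ [ cost σ e + s + t ]

-- Variable 0 holds the input at the start and the output at the end.

initial : Tree → Store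
initial v zero    = v
initial v (suc _) = nil

Run : Command → Tree → Tree → ℕ → Set
Run c input output t =
  ∃[ τ ] (initial input ⊢ c ⇓ τ [ t ]) × τ 0 ≡ output

unary : ℕ → Tree
unary zero    = nil
unary (suc n) = nil ∙ unary n

Computable : (ℕ → ℕ) → Set
Computable f =
  ∃[ c ] (∀ n → ∃[ t ] Run c (unary n) (unary (f n)) t)

------------------------------------------------------------------------
-- Encodings of data as trees

encodeBool : Bool → Tree
encodeBool false = nil
encodeBool true  = nil ∙ nil

encodeVec : ∀ {A : Set} {n} → (A → Tree) → Vec A n → Tree
encodeVec enc []       = nil
encodeVec enc (x ∷ xs) = enc x ∙ encodeVec enc xs

encodeℕᵇ : ℕᵇ → Tree
encodeℕᵇ ℕᵇ.zero  = nil
encodeℕᵇ 2[1+ b ] = encodeBool true  ∙ encodeℕᵇ b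
encodeℕᵇ 1+[2 b ] = encodeBool false ∙ encodeℕᵇ b

encodeℕ : ℕ → Tree
encodeℕ n = encodeℕᵇ (ℕᵇ.fromℕ n)

encodeℤ : ℤ → Tree
encodeℤ (+ n)    = encodeBool false ∙ encodeℕ n
encodeℤ -[1+ n ] = encodeBool true  ∙ encodeℕ (suc n)

encodeℚᵘ : ℚᵘ → Tree
encodeℚᵘ q = encodeℤ (↥ q) ∙ encodeℕ (↧ₙ q)

------------------------------------------------------------------------
-- Parameterized problems

-- The yes-instances are pairs (x , k) with parameter k.

record ParameterizedProblem : Set₁ where
  field
    Instance : Set
    encode   : Instance → Tree
    Yes      : Instance → ℕ → Set

open ParameterizedProblem

-- The parameter is written in unary.  Since it enters the time bound
-- through an arbitrary computable g, and k′ ≤ h k, the choice of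
-- numerals for it is immaterial.

_≤ᶠᵖᵗ_ : ParameterizedProblem → ParameterizedProblem → Set
P ≤ᶠᵖᵗ Q =
  ∃[ c ] ∃[ g ] ∃[ h ] ∃[ d ]
    Computable g × Computable h ×
    (∀ (x : Instance P) (k : ℕ) →
      ∃[ x′ ] ∃[ k′ ] ∃[ t ]
        Run c (encode P x ∙ unary k) (encode Q x′ ∙ unary k′) t ×
        t ≤ g k * size (encode P x) ^ d ×
        k′ ≤ h k ×
        (Yes P x k ⇔ Yes Q x′ k′))

infix 4 _≤ᶠᵖᵗ_

------------------------------------------------------------------------
-- Graphs

record Graph : Set₁ where
  field
    order  : ℕ
    Adj    : Rel (Fin order) 0ℓ
    symm   : Symmetric Adj
    irrefl : Irreflexive _≡_ Adj

module _ (H : Graph) where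
  open Graph H

  IsClique : Subset order → Set
  IsClique D = ∀ {u v} → u ∈ D → v ∈ D → u ≢ v → Adj u v

  IsDominating : Subset order → Set
  IsDominating D = ∀ v → v ∈ D ⊎ (∃[ u ] u ∈ D × Adj v u)

  Induced : Subset order → Rel (Fin order) 0ℓ
  Induced D u v = u ∈ D × v ∈ D × Adj u v

  IsConnected : Subset order → Set
  IsConnected D = ∀ {u v} → u ∈ D → v ∈ D → Star (Induced D) u v

GraphProperty : Set₁
GraphProperty = Graph → ℕ → Set

HasClique HasConnectedDominatingSet HasDominatingClique : GraphProperty
HasClique H k = ∃[ D ] ∣ D ∣ ≡ k × IsClique H D
HasConnectedDominatingSet H k =
  ∃[ D ] ∣ D ∣ ≡ k × IsDominating H D × IsConnected H D
HasDominatingClique H k =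
  ∃[ D ] ∣ D ∣ ≡ k × IsDominating H D × IsClique H D

------------------------------------------------------------------------
-- k-CLIQUE and W[1]-hardness

-- A general graph is given by its adjacency matrix.

record InputGraph : Set where
  field
    order  : ℕ
    matrix : Fin order → Fin order → Bool
    symm   : ∀ u v → matrix u v ≡ matrix v u
    irrefl : ∀ u → matrix u u ≡ false

encodeGraph : InputGraph → Tree
encodeGraph G = encodeVec (encodeVec encodeBool) (tabulate (tabulate ∘ matrix))
  where open InputGraph G

toGraph : InputGraph → Graph
toGraph G = record
  { order  = order
  ; Adj    = λ u v → matrix u v ≡ true
  ; symm   = λ {u} {v} uv → trans (symm v u) uv
  ; irrefl = λ { {u} refl uu → case trans (sym (irrefl u)) uu of λ () }
  }
  where open InputGraph G

k-Clique : ParameterizedProblem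
k-Clique = record
  { Instance = InputGraph
  ; encode   = encodeGraph
  ; Yes      = HasClique ∘ toGraph
  }

-- k-Clique is complete for W[1] under FPT reductions, so hardness for
-- the class amounts to a reduction from it.

W[1]-Hard : ParameterizedProblem → Set
W[1]-Hard Q = k-Clique ≤ᶠᵖᵗ Q

------------------------------------------------------------------------
-- Unit 3-track interval graphs

intersectionGraph : ∀ {A : Set} {n} → (Fin n → Pred A 0ℓ) → Graph
intersectionGraph {n = n} F = record
  { order  = n
  ; Adj    = λ i j → i ≢ j × F i ≬ F j
  ; symm   = λ { (i≢j , p , pᵢ , pⱼ) → (i≢j ∘ sym) , p , pⱼ , pᵢ }
  ; irrefl = λ { i≡j (i≢j , _) → i≢j i≡j }
  }

-- A unit 3-track interval is given by the left endpoints of its three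
-- closed intervals of length 1.  A representation is part of the input,
-- so endpoints are rational; closed intervals with rational endpoints
-- meet in the real line iff they meet in a rational point.

Unit3TrackInterval : Set
Unit3TrackInterval = Vec ℚᵘ 3

Point : Set
Point = Fin 3 × ℚᵘ

⟦_⟧ : Unit3TrackInterval → Pred Point 0ℓ
⟦ I ⟧ (track , x) = a ℚᵘ.≤ x × x ℚᵘ.≤ a ℚᵘ.+ 1ℚᵘ
  where a = lookup I track

record Unit3TrackRepresentation : Set where
  field
    {order} : ℕ
    members : Vec Unit3TrackInterval order

  graph : Graph
  graph = intersectionGraph (λ i → ⟦ lookup members i ⟧)

encodeRepresentation : Unit3TrackRepresentation → Tree
encodeRepresentation R = encodeVec (encodeVec encodeℚᵘ) members
  where open Unit3TrackRepresentation R

onUnit3TrackIntervalGraphs : GraphProperty → ParameterizedProblem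
onUnit3TrackIntervalGraphs Π = record
  { Instance = Unit3TrackRepresentation
  ; encode   = encodeRepresentation
  ; Yes      = Π ∘ Unit3TrackRepresentation.graph
  }

{-# OPTIONS --safe #-}
module Submission where

-- Suppose that G has n vertices.  For i, j < k the graph H contains a class
-- of candidates (i , j , u , v), where u and v are meant to be the i-th and
-- the j-th vertex of a clique of G and must be adjacent if i < j.  All the
-- candidates share a point of the first track.  Two private neighbourhoods
-- (guards) per class force a dominating set of k² vertices to consist of one
-- candidate (i , j , Uᵢⱼ , Vᵢⱼ) from each class.  On the second (third) track a
-- candidate is displaced according to u (v), so that an interval next to its
-- class meets it iff u (v) is on the proper side of a threshold; with such
-- intervals on both tracks, further vertices of H can only be dominated if
-- Uᵢⱼ = Vₗᵢ for all i, j, l.  Then Uᵢᵢ is the i-th vertex of a clique.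
-- Conversely, a clique of G yields a dominating clique of k² candidates.
--
-- Rank p is represented by the displacement 1 − 2⁻⁽ᵖ⁺¹⁾: the digits of such endpoints
-- are assembled from unary counters without any arithmetic.

open import Defs
open import Algebra.Properties.CommutativeSemigroup using (x∙yz≈y∙xz)
open import Data.Bool.Base using (Bool; true; false; if_then_else_)
open import Data.Empty using (⊥-elim)
open import Data.Fin.Base as Fin using (Fin; zero; suc; combine; remQuot)
open import Data.Fin.Patterns using (0F; 1F; 2F; 3F)
open import Data.Fin.Properties as Fin using (injective⇒≤; any?)
open import Data.Fin.Subset
  using (Subset; _∈_; ∣_∣; ⁅_⁆; _∪_; _-_; inside; outside; ⊥)
open import Data.Fin.Subset.Properties
  using ( x∈p⇒∣p-x∣<∣p∣; x∈p∧x≢y⇒x∈p-y; x∈p∪q⁻; x∈p∪q⁺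
        ; x∈⁅x⁆; x∈⁅y⁆⇒x≡y; ∉⊥)
open import Data.Integer.Base as ℤ using (+≤+) renaming (+_ to pos)
import Data.Integer.Properties as ℤ
open import Data.List.Base using (List; []; _∷_; _++_; foldr)
open import Data.List.Membership.Propositional renaming (_∈_ to _∈ˡ_) using ()
open import Data.List.Membership.Propositional.Properties using (∈-++⁺ˡ; ∈-++⁺ʳ)
open import Data.List.Properties using (foldr-++)
open import Data.List.Relation.Unary.All using (All; []; _∷_)
open import Data.List.Relation.Unary.All.Properties using (++⁺)
open import Data.List.Relation.Unary.Any using (here; there)
open import Data.Nat.Base hiding (_/_; _%_)
open import Data.Nat.Binary.Base as ℕᵇ using (ℕᵇ; 2[1+_]; 1+[2_]; zero; toℕ)
open import Data.Nat.Binary.Properties using (fromℕ-toℕ; toℕ-injective)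
open import Data.Nat.Properties
open import Data.Nat.Tactic.RingSolver using (solve-∀)
open import Data.Product.Base using (∃-syntax; _×_; _,_; proj₁; proj₂; uncurry)
open import Data.Rational.Unnormalised.Base as ℚᵘ
  using (ℚᵘ; mkℚᵘ; *≤*; ↥_; ↧_; 1ℚᵘ)
import Data.Rational.Unnormalised.Properties as ℚᵘ
open import Data.Sum.Base using (inj₁; inj₂; [_,_]′)
open import Data.Unit.Base using (⊤; tt)
open import Data.Vec.Base as Vec
  using (Vec; []; _∷_; lookup; tabulate; here; there)
open import Data.Vec.Properties using (lookup-map)
open import Data.Vec.Relation.Binary.Pointwise.Inductive
  using (Pointwise; []; _∷_)
open import Function.Base using (_∘_; case_of_)
open import Function.Bundles using (_⇔_; mk⇔)
open import Function.Definitions using (Injective)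
open import Relation.Binary.Construct.Closure.ReflexiveTransitive using (ε; _◅_)
open import Relation.Binary.Definitions using (tri<; tri≈; tri>)
open import Relation.Binary.PropositionalEquality
open import Relation.Nullary using (¬_; yes; no; contradiction)

-- Adjacency in G is encoded by which candidates exist; the other vertices only have to make the
-- chosen candidates agree. A test has one interval on each track, so it can compare a first
-- coordinate (second track) with a second coordinate (third track), but not two first coordinates.
-- Hence `U i j` is compared with `V l i` for all `j` and `l`, and the `U i j` agree with one
-- another through the `V l i`. The first track remains free for making all candidates pairwise
-- adjacent.
--
-- A single guard per class would not do, since it could be selected itself. The two guards of a
-- class do not meet each other, and nothing but a candidate meets both.
--
-- Tracing the running time directly in the cost semantics of WHILE would be laborious. The
-- reduction is therefore written in a small loop language whose programs carry a polynomial time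
-- bound by construction. Its only numbers are lengths of list suffixes, and it cannot compare them;
-- this is why vertices enter through their ranks, and why the candidates with `i < j` are produced
-- by the shape of the loops.

update-same : ∀ (σ : Store) x {v} → (σ [ x ↦ v ]) x ≡ v
update-same σ x with x ≡ᵇ x | ≡⇒≡ᵇ x x refl
... | true | _ = refl

update-other : ∀ (σ : Store) x {v y} → y ≢ x → (σ [ x ↦ v ]) y ≡ σ y
update-other σ x {_} {y} y≢x with x ≡ᵇ y | ≡ᵇ⇒≡ x y
... | true  | x≡y = contradiction (sym (x≡y tt)) y≢x
... | false | _   = refl

-- Polynomials

data Poly : Set where
  𝕏       : Poly
  𝕂       : ℕ → Poly
  _⊕_ _⊗_ : Poly → Poly → Poly
  _⊚_     : Poly → Poly → Poly

infixl 6 _⊕_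
infixl 7 _⊗_
infixl 8 _⊚_

⟪_⟫ : Poly → ℕ → ℕ
⟪ 𝕏 ⟫     n = n
⟪ 𝕂 c ⟫   n = c
⟪ p ⊕ q ⟫ n = ⟪ p ⟫ n + ⟪ q ⟫ n
⟪ p ⊗ q ⟫ n = ⟪ p ⟫ n * ⟪ q ⟫ n
⟪ p ⊚ q ⟫ n = ⟪ p ⟫ (⟪ q ⟫ n)

poly-mono : ∀ p {m n} → m ≤ n → ⟪ p ⟫ m ≤ ⟪ p ⟫ n
poly-mono 𝕏       m≤n = m≤n
poly-mono (𝕂 c)   m≤n = ≤-refl
poly-mono (p ⊕ q) m≤n = +-mono-≤ (poly-mono p m≤n) (poly-mono q m≤n)
poly-mono (p ⊗ q) m≤n = *-mono-≤ (poly-mono p m≤n) (poly-mono q m≤n)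
poly-mono (p ⊚ q) m≤n = poly-mono p (poly-mono q m≤n)

[m*n]^d : ∀ m n d → (m * n) ^ d ≡ m ^ d * n ^ d
[m*n]^d m n zero    = refl
[m*n]^d m n (suc d) = trans (cong (m * n *_) ([m*n]^d m n d)) ([m*n]*[o*p]≡[m*o]*[n*p] m n (m ^ d) (n ^ d))

module _ where
  open ≤-Reasoning

  bound-⊕ : ∀ c d c′ d′ n {x y} → x ≤ c * suc n ^ d → y ≤ c′ * suc n ^ d′ → x + y ≤ (c + c′) * suc n ^ (d + d′)
  bound-⊕ c d c′ d′ n {x} {y} x≤ y≤ = begin
    x + y                                         ≤⟨ +-mono-≤ x≤ y≤ ⟩
    c * suc n ^ d + c′ * suc n ^ d′
      ≤⟨ +-mono-≤ (*-monoʳ-≤ c (^-monoʳ-≤ (suc n) (m≤m+n d d′))) (*-monoʳ-≤ c′ (^-monoʳ-≤ (suc n) (m≤n+m d′ d))) ⟩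
    c * suc n ^ (d + d′) + c′ * suc n ^ (d + d′)  ≡⟨ *-distribʳ-+ (suc n ^ (d + d′)) c c′ ⟨
    (c + c′) * suc n ^ (d + d′)                   ∎

  bound-⊗ : ∀ c d c′ d′ n {x y} → x ≤ c * suc n ^ d → y ≤ c′ * suc n ^ d′ → x * y ≤ c * c′ * suc n ^ (d + d′)
  bound-⊗ c d c′ d′ n {x} {y} x≤ y≤ = begin
    x * y                                ≤⟨ *-mono-≤ x≤ y≤ ⟩
    c * suc n ^ d * (c′ * suc n ^ d′)    ≡⟨ [m*n]*[o*p]≡[m*o]*[n*p] c (suc n ^ d) c′ (suc n ^ d′) ⟩
    c * c′ * (suc n ^ d * suc n ^ d′)    ≡⟨ cong (c * c′ *_) (^-distribˡ-+-* (suc n) d d′) ⟨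
    c * c′ * suc n ^ (d + d′)            ∎

  bound-⊚ : ∀ c d c′ d′ n {x y} → x ≤ c * suc y ^ d → y ≤ c′ * suc n ^ d′ → x ≤ c * suc c′ ^ d * suc n ^ (d′ * d)
  bound-⊚ c d c′ d′ n {x} {y} x≤ y≤ = begin
    x                                    ≤⟨ x≤ ⟩
    c * suc y ^ d                        ≤⟨ *-monoʳ-≤ c (^-monoˡ-≤ d (+-mono-≤ (m^n>0 (suc n) d′) y≤)) ⟩
    c * (suc c′ * suc n ^ d′) ^ d        ≡⟨ cong (c *_) ([m*n]^d (suc c′) (suc n ^ d′) d) ⟩
    c * (suc c′ ^ d * (suc n ^ d′) ^ d)  ≡⟨ cong (λ e → c * (suc c′ ^ d * e)) (^-*-assoc (suc n) d′ d) ⟩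
    c * (suc c′ ^ d * suc n ^ (d′ * d))  ≡⟨ *-assoc c (suc c′ ^ d) (suc n ^ (d′ * d)) ⟨
    c * suc c′ ^ d * suc n ^ (d′ * d)    ∎

-- Powers of `suc n` are positive even for `n = 0`, so constants and lower powers can be absorbed
-- into higher ones.
poly-bound : ∀ p → ∃[ c ] ∃[ d ] (∀ n → ⟪ p ⟫ n ≤ c * suc n ^ d)
poly-bound 𝕏     = 1 , 1 , λ n → ≤-trans (n≤1+n n) (≤-reflexive (sym (trans (*-identityˡ _) (*-identityʳ (suc n)))))
poly-bound (𝕂 c) = c , 0 , λ n → ≤-reflexive (sym (*-identityʳ c))
poly-bound (p ⊕ q) =
  let c , d , p≤ = poly-bound p; c′ , d′ , q≤ = poly-bound q
  in  c + c′ , d + d′ , λ n → bound-⊕ c d c′ d′ n (p≤ n) (q≤ n)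
poly-bound (p ⊗ q) =
  let c , d , p≤ = poly-bound p; c′ , d′ , q≤ = poly-bound q
  in  c * c′ , d + d′ , λ n → bound-⊗ c d c′ d′ n (p≤ n) (q≤ n)
poly-bound (p ⊚ q) =
  let c , d , p≤ = poly-bound p; c′ , d′ , q≤ = poly-bound q
  in  c * suc c′ ^ d , d′ * d , λ n → bound-⊚ c d c′ d′ n (p≤ (⟪ q ⟫ n)) (q≤ n)

-- A language of polynomial-time programs

data Ex (m : ℕ) : Set where
  var   : Fin m → Ex m
  nil   : Ex m
  cons  : Ex m → Ex m → Ex m
  hd tl : Ex m → Ex m

Env : ℕ → Set
Env = Vec Tree

value : ∀ {m} → Env m → Ex m → Tree
value ρ (var i)    = lookup ρ i
value ρ nil        = nil
value ρ (cons d e) = value ρ d ∙ value ρ e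
value ρ (hd e)     = left (value ρ e)
value ρ (tl e)     = right (value ρ e)

-- A generator pushes trees onto an accumulator which it cannot inspect.
-- A loop can therefore not iterate over what it builds, which keeps
-- every generator polynomial.

data Gen (m : ℕ) : Set where
  skip : Gen m
  push : Ex m → Gen m → Gen m
  _⨾_  : Gen m → Gen m → Gen m
  ite  : Ex m → Gen m → Gen m → Gen m
  for  : Ex m → Gen (suc m) → Gen m

branch : ∀ {A : Set} → Tree → A → A → A
branch nil     x y = y
branch (_ ∙ _) x y = x

-- The loop variable holds the remaining suffix rather than an element: its head is the element, its
-- length is a unary counter, and its tail allows an inner loop over the later elements only.
overSuffixes : Tree → (Tree → Tree → Tree) → Tree → Tree
overSuffixes nil     f acc = acc
overSuffixes (l ∙ r) f acc = overSuffixes r f (f (l ∙ r) acc)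

⟦_⟧ᵍ : ∀ {m} → Gen m → Env m → Tree → Tree
⟦ skip ⟧ᵍ      ρ acc = acc
⟦ push e g ⟧ᵍ  ρ acc = ⟦ g ⟧ᵍ ρ (value ρ e) ∙ acc
⟦ g ⨾ h ⟧ᵍ     ρ acc = ⟦ h ⟧ᵍ ρ (⟦ g ⟧ᵍ ρ acc)
⟦ ite e g h ⟧ᵍ ρ acc = branch (value ρ e) (⟦ g ⟧ᵍ ρ acc) (⟦ h ⟧ᵍ ρ acc)
⟦ for e g ⟧ᵍ   ρ acc = overSuffixes (value ρ e) (λ t → ⟦ g ⟧ᵍ (t ∷ ρ)) acc

-- Compilation to WHILE programs, with resource bounds

compileEx : ∀ {m} → Vec ℕ m → Ex m → Expr
compileEx xs (var i)    = var (lookup xs i)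
compileEx xs nil        = nil
compileEx xs (cons d e) = cons (compileEx xs d) (compileEx xs e)
compileEx xs (hd e)     = hd (compileEx xs e)
compileEx xs (tl e)     = tl (compileEx xs e)

-- The accumulator is variable a, the environment is held by the
-- variables xs, and the variables from b on are free for use.

compile : ∀ {m} → ℕ → Vec ℕ m → ℕ → Gen m → Command
compile a xs b skip        = a ≔ var a
compile a xs b (push e g)  =
  b ≔ compileEx xs e ⨾ compile b xs (suc b) g ⨾ a ≔ cons (var b) (var a)
compile a xs b (g ⨾ h)     = compile a xs b g ⨾ compile a xs b h
compile a xs b (ite e g h) =
  if′ compileEx xs e then compile a xs b g else compile a xs b h
compile a xs b (for e g)   =
  b ≔ compileEx xs e ⨾
  while var b repeat (compile a (b ∷ xs) (suc b) g ⨾ b ≔ tl (var b))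

-- The argument bounds the size of every tree in the environment; in `timeᵖ` it bounds the initial
-- accumulator as well.
sizeᵖ costᵖ : ∀ {m} → Ex m → Poly
sizeᵖ (var i)    = 𝕏
sizeᵖ nil        = 𝕂 1
sizeᵖ (cons d e) = 𝕂 1 ⊕ sizeᵖ d ⊕ sizeᵖ e
sizeᵖ (hd e)     = sizeᵖ e
sizeᵖ (tl e)     = sizeᵖ e
costᵖ (var i)    = 𝕏
costᵖ nil        = 𝕂 1
costᵖ (cons d e) = costᵖ d ⊕ costᵖ e ⊕ sizeᵖ (cons d e)
costᵖ (hd e)     = costᵖ e ⊕ sizeᵖ e
costᵖ (tl e)     = costᵖ e ⊕ sizeᵖ e

-- Bounds what is added to the accumulator, in terms of the environment alone. Composition enters
-- because a loop body also sees the loop variable.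
growthᵖ : ∀ {m} → Gen m → Poly
growthᵖ skip        = 𝕂 0
growthᵖ (push e g)  = 𝕂 1 ⊕ (sizeᵖ e ⊕ growthᵖ g)
growthᵖ (g ⨾ h)     = growthᵖ g ⊕ growthᵖ h
growthᵖ (ite e g h) = growthᵖ g ⊕ growthᵖ h
growthᵖ (for e g)   = sizeᵖ e ⊗ growthᵖ g ⊚ (𝕏 ⊕ sizeᵖ e)

timeᵖ : ∀ {m} → Gen m → Poly
timeᵖ skip        = 𝕏
timeᵖ (push e g)  = costᵖ e ⊕ (timeᵖ g ⊚ (𝕏 ⊕ sizeᵖ e) ⊕ (S ⊕ 𝕏 ⊕ (𝕂 1 ⊕ S ⊕ 𝕏)))
  where S = sizeᵖ e ⊕ growthᵖ g
timeᵖ (g ⨾ h)     = timeᵖ g ⊕ timeᵖ h ⊚ (𝕏 ⊕ growthᵖ g)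
timeᵖ (ite e g h) = costᵖ e ⊕ (timeᵖ g ⊕ timeᵖ h)
-- The body is timed at a bound for the environment, the loop variable and the accumulator at any
-- moment of the loop. The three further `S` pay for the loop test and for `tl`, the final 1 for the
-- test that fails.
timeᵖ (for e g)   = costᵖ e ⊕ (sizeᵖ e ⊗ (S ⊕ (timeᵖ g ⊚ (𝕏 ⊕ S ⊕ S ⊗ growthᵖ g ⊚ (𝕏 ⊕ S)) ⊕ (S ⊕ S))) ⊕ 𝕂 1)
  where S = sizeᵖ e

module _ {m : ℕ} where

  Holds : Store → Vec ℕ m → Env m → Set
  Holds σ xs ρ = ∀ i → σ (lookup xs i) ≡ lookup ρ i

  Bounded : ℕ → Env m → Set
  Bounded z ρ = ∀ i → size (lookup ρ i) ≤ z

size-left : ∀ t → size (left t) ≤ size t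
size-left nil     = ≤-refl
size-left (l ∙ r) = ≤-trans (m≤m+n (size l) (size r)) (n≤1+n _)

size-right : ∀ t → size (right t) ≤ size t
size-right nil     = ≤-refl
size-right (l ∙ r) = ≤-trans (m≤n+m (size r) (size l)) (n≤1+n _)

eval-compileEx : ∀ {m σ} {xs : Vec ℕ m} {ρ} → Holds σ xs ρ → ∀ e → eval σ (compileEx xs e) ≡ value ρ e
eval-compileEx H (var i)    = H i
eval-compileEx H nil        = refl
eval-compileEx H (cons d e) = cong₂ _∙_ (eval-compileEx H d) (eval-compileEx H e)
eval-compileEx H (hd e)     = cong left (eval-compileEx H e)
eval-compileEx H (tl e)     = cong right (eval-compileEx H e)

size-value : ∀ {m z} {ρ : Env m} → Bounded z ρ → ∀ e → size (value ρ e) ≤ ⟪ sizeᵖ e ⟫ z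
size-value B (var i)    = B i
size-value B nil        = ≤-refl
size-value B (cons d e) = s≤s (+-mono-≤ (size-value B d) (size-value B e))
size-value B (hd e)     = ≤-trans (size-left (value _ e)) (size-value B e)
size-value B (tl e)     = ≤-trans (size-right (value _ e)) (size-value B e)

cost-compileEx : ∀ {m z σ} {xs : Vec ℕ m} {ρ} → Holds σ xs ρ → Bounded z ρ → ∀ e →
                 cost σ (compileEx xs e) ≤ ⟪ costᵖ e ⟫ z
cost-compileEx {σ = σ} {xs} {ρ} H B e₀ = go e₀
  where
  size-eval : ∀ e → size (eval σ (compileEx xs e)) ≤ ⟪ sizeᵖ e ⟫ _
  size-eval e = subst (λ t → size t ≤ _) (sym (eval-compileEx {xs = xs} {ρ} H e)) (size-value B e)
  go : ∀ e → cost σ (compileEx xs e) ≤ ⟪ costᵖ e ⟫ _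
  go (var i)    = subst (λ t → size t ≤ _) (sym (H i)) (B i)
  go nil        = ≤-refl
  go (cons d e) = +-mono-≤ (+-mono-≤ (go d) (go e)) (size-eval (cons d e))
  go (hd e)     = +-mono-≤ (go e) (≤-trans (size-left (eval σ (compileEx xs e))) (size-eval e))
  go (tl e)     = +-mono-≤ (go e) (≤-trans (size-right (eval σ (compileEx xs e))) (size-eval e))

bounded-mono : ∀ {m y z} {ρ : Env m} → y ≤ z → Bounded y ρ → Bounded z ρ
bounded-mono y≤z B i = ≤-trans (B i) y≤z

bounded-∷ : ∀ {m z t} {ρ : Env m} → size t ≤ z → Bounded z ρ → Bounded z (t ∷ ρ)
bounded-∷ t≤z B zero    = t≤z
bounded-∷ t≤z B (suc i) = B i

len : Tree → ℕ
len nil     = 0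
len (l ∙ r) = suc (len r)

len≤size : ∀ t → len t ≤ size t
len≤size nil     = z≤n
len≤size (l ∙ r) = s≤s (≤-trans (len≤size r) (m≤n+m (size r) (size l)))

size-overSuffixes : ∀ {f b s} t →
  (∀ t′ acc → size t′ ≤ s → size (f t′ acc) ≤ size acc + b) →
  size t ≤ s → ∀ acc → size (overSuffixes t f acc) ≤ size acc + len t * b
size-overSuffixes nil h t≤s acc = m≤m+n (size acc) 0
size-overSuffixes {f} {b} (l ∙ r) h t≤s acc = begin
  size (overSuffixes r f (f (l ∙ r) acc))
    ≤⟨ size-overSuffixes r h (≤-trans (size-right (l ∙ r)) t≤s) _ ⟩
  size (f (l ∙ r) acc) + len r * b        ≤⟨ +-monoˡ-≤ (len r * b) (h (l ∙ r) acc t≤s) ⟩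
  size acc + b + len r * b                ≡⟨ +-assoc (size acc) b (len r * b) ⟩
  size acc + suc (len r) * b              ∎
  where open ≤-Reasoning

-- Here `z` bounds the environment but not `acc`, which no expression can read. Hence the growth of
-- successive iterations adds up instead of compounding.
size-gen : ∀ {m z} (g : Gen m) {ρ} → Bounded z ρ → ∀ acc → size (⟦ g ⟧ᵍ ρ acc) ≤ size acc + ⟪ growthᵖ g ⟫ z
size-gen skip B acc = m≤m+n (size acc) 0
size-gen {z = z} (push e g) {ρ} B acc = begin
  suc (size (⟦ g ⟧ᵍ ρ (value ρ e)) + size acc)
    ≤⟨ s≤s (+-monoˡ-≤ (size acc) (size-gen g B (value ρ e))) ⟩
  suc (size (value ρ e) + ⟪ growthᵖ g ⟫ z + size acc)
    ≤⟨ s≤s (+-monoˡ-≤ (size acc) (+-monoˡ-≤ (⟪ growthᵖ g ⟫ z) (size-value B e))) ⟩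
  suc (⟪ sizeᵖ e ⟫ z + ⟪ growthᵖ g ⟫ z + size acc)
    ≡⟨ +-comm (suc (⟪ sizeᵖ e ⟫ z + ⟪ growthᵖ g ⟫ z)) (size acc) ⟩
  size acc + suc (⟪ sizeᵖ e ⟫ z + ⟪ growthᵖ g ⟫ z)           ∎
  where open ≤-Reasoning
size-gen {z = z} (g ⨾ h) {ρ} B acc = begin
  size (⟦ h ⟧ᵍ ρ (⟦ g ⟧ᵍ ρ acc))                       ≤⟨ size-gen h B _ ⟩
  size (⟦ g ⟧ᵍ ρ acc) + ⟪ growthᵖ h ⟫ z
    ≤⟨ +-monoˡ-≤ (⟪ growthᵖ h ⟫ z) (size-gen g B acc) ⟩
  size acc + ⟪ growthᵖ g ⟫ z + ⟪ growthᵖ h ⟫ z         ≡⟨ +-assoc (size acc) _ _ ⟩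
  size acc + (⟪ growthᵖ g ⟫ z + ⟪ growthᵖ h ⟫ z)       ∎
  where open ≤-Reasoning
size-gen (ite e g h) {ρ} B acc with value ρ e
... | nil   = ≤-trans (size-gen h B acc) (+-monoʳ-≤ (size acc) (m≤n+m _ _))
... | _ ∙ _ = ≤-trans (size-gen g B acc) (+-monoʳ-≤ (size acc) (m≤m+n _ _))
size-gen {z = z} (for e g) {ρ} B acc = begin
  size (overSuffixes (value ρ e) (λ t → ⟦ g ⟧ᵍ (t ∷ ρ)) acc)
    ≤⟨ size-overSuffixes (value ρ e) (λ t′ acc′ t′≤ → size-gen g (bounded-∷ (≤-trans t′≤ (m≤n+m _ z)) (bounded-mono {ρ = ρ} (m≤m+n z _) B)) acc′) (size-value B e) acc ⟩
  size acc + len (value ρ e) * ⟪ growthᵖ g ⟫ (z + ⟪ sizeᵖ e ⟫ z)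
    ≤⟨ +-monoʳ-≤ (size acc) (*-monoˡ-≤ (⟪ growthᵖ g ⟫ (z + ⟪ sizeᵖ e ⟫ z)) (≤-trans (len≤size (value ρ e)) (size-value B e))) ⟩
  size acc + ⟪ sizeᵖ e ⟫ z * ⟪ growthᵖ g ⟫ (z + ⟪ sizeᵖ e ⟫ z) ∎
  where open ≤-Reasoning

record Fresh {m} (a : ℕ) (xs : Vec ℕ m) (b : ℕ) : Set where
  field
    acc<  : a < b
    env<  : ∀ i → lookup xs i < b
    acc∉  : ∀ i → lookup xs i ≢ a

open Fresh

fresh-∷ : ∀ {m a b} {xs : Vec ℕ m} → Fresh a xs b → Fresh a (b ∷ xs) (suc b)
fresh-∷ F .acc<         = m<n⇒m<1+n (acc< F)
fresh-∷ F .env< zero    = n<1+n _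
fresh-∷ F .env< (suc i) = m<n⇒m<1+n (env< F i)
fresh-∷ F .acc∉ zero    = >⇒≢ (acc< F)
fresh-∷ F .acc∉ (suc i) = acc∉ F i

fresh-acc : ∀ {m a b} {xs : Vec ℕ m} → Fresh a xs b → Fresh b xs (suc b)
fresh-acc F .acc<   = n<1+n _
fresh-acc F .env< i = m<n⇒m<1+n (env< F i)
fresh-acc F .acc∉ i = <⇒≢ (env< F i)

-- Variables from `b` on are scratch space. When `push` accumulates in `b`, this same property
-- protects the outer accumulator.
Preserves : ℕ → ℕ → Store → Store → Set
Preserves a b σ τ = ∀ {y} → y < b → y ≢ a → τ y ≡ σ y

holds-preserved : ∀ {m a b σ τ} {xs : Vec ℕ m} {ρ} → Fresh a xs b →
                  Preserves a b σ τ → Holds σ xs ρ → Holds τ xs ρ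
holds-preserved F P H i = trans (P (env< F i) (acc∉ F i)) (H i)

preserves-scratch : ∀ {a b v} (σ : Store) → Preserves a b σ (σ [ b ↦ v ])
preserves-scratch {b = b} σ y<b _ = update-other σ b (<⇒≢ y<b)

Result : Store → Command → (Store → Set) → ℕ → Set
Result σ c Q s = ∃[ τ ] ∃[ t ] σ ⊢ c ⇓ τ [ t ] × Q τ × t ≤ s

Correct : ∀ {m} → Gen m → Set
Correct {m} g = ∀ {a b} {xs : Vec ℕ m} → Fresh a xs b → ∀ {σ ρ z} →
  Holds σ xs ρ → Bounded z ρ → size (σ a) ≤ z →
  Result σ (compile a xs b g) (λ τ → τ a ≡ ⟦ g ⟧ᵍ ρ (σ a) × Preserves a b σ τ) (⟪ timeᵖ g ⟫ z)

module _ {m : ℕ} (g : Gen (suc m)) (g-correct : Correct g) {a b : ℕ} {xs : Vec ℕ m} (F : Fresh a xs b)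
         {ρ : Env m} {s y z : ℕ} (B : Bounded y ρ) (s≤y : s ≤ y) (y≤z : y ≤ z) where

  private
    stepTime : ℕ
    stepTime = s + (⟪ timeᵖ g ⟫ z + (s + s))

    body : Command
    body = compile a (b ∷ xs) (suc b) g ⨾ b ≔ tl (var b)

  -- Two bounds are kept apart: `y` for the environment, `z` for the accumulator too. The last
  -- hypothesis is the invariant: the accumulator plus the growth of all remaining iterations stays
  -- within `z`, so one time bound for the body serves every iteration.
  loop-correct : ∀ t {σ} → σ b ≡ t → Holds σ xs ρ → size t ≤ s →
    size (σ a) + len t * ⟪ growthᵖ g ⟫ y ≤ z →
    Result σ (while var b repeat body)
      (λ τ → τ a ≡ overSuffixes t (λ t′ → ⟦ g ⟧ᵍ (t′ ∷ ρ)) (σ a) × Preserves a b σ τ)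
      (len t * stepTime + 1)
  loop-correct nil {σ} σb≡t H t≤s acc≤z =
    σ , _ , stop σb≡t , (refl , λ _ _ → refl) , ≤-reflexive (cong size σb≡t)
  loop-correct t@(l ∙ r) {σ} σb≡t H t≤s acc≤z =
    τ′ , _ , loop σb≡t (seq run assign) run′ ,
    (trans τ′a≡ (cong (overSuffixes r _) (trans τ₂a≡τa τa≡)) ,
     λ y<b y≢a → trans (P′ y<b y≢a) (trans (preserves-scratch τ y<b y≢a) (P (m<n⇒m<1+n y<b) y≢a))) ,
    time-bound
    where
    open ≤-Reasoning
    H₁ : Holds σ (b ∷ xs) (t ∷ ρ)
    H₁ zero    = σb≡t
    H₁ (suc i) = H i
    B₁ : Bounded y (t ∷ ρ)
    B₁ = bounded-∷ (≤-trans t≤s s≤y) B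
    iteration = g-correct (fresh-∷ F) H₁ (bounded-mono {ρ = t ∷ ρ} y≤z B₁) (≤-trans (m≤m+n _ _) acc≤z)
    τ   = proj₁ iteration
    run = proj₁ (proj₂ (proj₂ iteration))
    τa≡ : τ a ≡ ⟦ g ⟧ᵍ (t ∷ ρ) (σ a)
    τa≡ = proj₁ (proj₁ (proj₂ (proj₂ (proj₂ iteration))))
    P : Preserves a (suc b) σ τ
    P = proj₂ (proj₁ (proj₂ (proj₂ (proj₂ iteration))))
    τb≡t : τ b ≡ t
    τb≡t = trans (P (n<1+n b) (>⇒≢ (acc< F))) σb≡t
    τ₂ : Store
    τ₂ = τ [ b ↦ right (τ b) ]
    τ₂a≡τa : τ₂ a ≡ τ a
    τ₂a≡τa = update-other τ b (<⇒≢ (acc< F))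
    H₂ : Holds τ₂ xs ρ
    H₂ i = trans (update-other τ b (<⇒≢ (env< F i)))
                 (trans (P (m<n⇒m<1+n (env< F i)) (acc∉ F i)) (H i))
    acc₂≤z : size (τ₂ a) + len r * ⟪ growthᵖ g ⟫ y ≤ z
    acc₂≤z = begin
      size (τ₂ a) + len r * ⟪ growthᵖ g ⟫ y
        ≡⟨ cong (λ acc → size acc + len r * ⟪ growthᵖ g ⟫ y) (trans τ₂a≡τa τa≡) ⟩
      size (⟦ g ⟧ᵍ (t ∷ ρ) (σ a)) + len r * ⟪ growthᵖ g ⟫ y
        ≤⟨ +-monoˡ-≤ (len r * ⟪ growthᵖ g ⟫ y) (size-gen g B₁ (σ a)) ⟩
      size (σ a) + ⟪ growthᵖ g ⟫ y + len r * ⟪ growthᵖ g ⟫ y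
        ≡⟨ +-assoc (size (σ a)) _ _ ⟩
      size (σ a) + len t * ⟪ growthᵖ g ⟫ y
        ≤⟨ acc≤z ⟩
      z ∎
    rest = loop-correct r (trans (update-same τ b) (cong right τb≡t)) H₂ (≤-trans (size-right t) t≤s) acc₂≤z
    τ′   = proj₁ rest
    run′ = proj₁ (proj₂ (proj₂ rest))
    τ′a≡ = proj₁ (proj₁ (proj₂ (proj₂ (proj₂ rest))))
    P′ : Preserves a b τ₂ τ′
    P′ = proj₂ (proj₁ (proj₂ (proj₂ (proj₂ rest))))
    τb≤s : size (τ b) ≤ s
    τb≤s = subst (λ t′ → size t′ ≤ s) (sym τb≡t) t≤s
    time-bound = begin
      size (σ b) + (proj₁ (proj₂ iteration) + (size (τ b) + size (right (τ b)))) + proj₁ (proj₂ rest)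
        ≤⟨ +-mono-≤ (+-mono-≤ (subst (λ t′ → size t′ ≤ s) (sym σb≡t) t≤s)
             (+-mono-≤ (proj₂ (proj₂ (proj₂ (proj₂ iteration))))
               (+-mono-≤ τb≤s (≤-trans (size-right (τ b)) τb≤s))))
             (proj₂ (proj₂ (proj₂ (proj₂ rest)))) ⟩
      stepTime + (len r * stepTime + 1)
        ≡⟨ +-assoc stepTime _ 1 ⟨
      len t * stepTime + 1 ∎

compile-correct : ∀ {m} (g : Gen m) → Correct g
compile-correct skip {a} {b} F {σ} H B acc≤z =
  _ , _ , assign , (update-same σ a , λ _ y≢a → update-other σ a y≢a) , acc≤z
compile-correct (push e g) {a} {b} {xs} F {σ} {ρ} {z} H B acc≤z =
  _ , _ , seq assign (seq run assign) ,
  (trans (update-same τ a) (cong₂ _∙_ (trans τb≡ (cong (⟦ g ⟧ᵍ ρ) σ₁b≡)) τa≡) ,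
   λ y<b y≢a → trans (update-other τ a y≢a) (trans (P (m<n⇒m<1+n y<b) (<⇒≢ y<b)) (preserves-scratch σ y<b y≢a))) ,
  +-mono-≤ (cost-compileEx {xs = xs} {ρ} H B e) (+-mono-≤ t≤ (+-mono-≤ (+-mono-≤ τb≤ τa≤) (s≤s (+-mono-≤ τb≤ τa≤))))
  where
  S = ⟪ sizeᵖ e ⟫ z
  σ₁ : Store
  σ₁ = σ [ b ↦ eval σ (compileEx xs e) ]
  σ₁b≡ : σ₁ b ≡ value ρ e
  σ₁b≡ = trans (update-same σ b) (eval-compileEx {xs = xs} {ρ} H e)
  σ₁b≤ : size (σ₁ b) ≤ z + S
  σ₁b≤ = ≤-trans (subst (λ t → size t ≤ S) (sym σ₁b≡) (size-value B e)) (m≤n+m S z)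
  inner = compile-correct g (fresh-acc F) {σ₁} {ρ} {z + S}
    (λ i → trans (update-other σ b (<⇒≢ (env< F i))) (H i))
    (bounded-mono {ρ = ρ} (m≤m+n z S) B) σ₁b≤
  τ   = proj₁ inner
  run = proj₁ (proj₂ (proj₂ inner))
  τb≡ : τ b ≡ ⟦ g ⟧ᵍ ρ (σ₁ b)
  τb≡ = proj₁ (proj₁ (proj₂ (proj₂ (proj₂ inner))))
  P : Preserves b (suc b) σ₁ τ
  P   = proj₂ (proj₁ (proj₂ (proj₂ (proj₂ inner))))
  t≤  = proj₂ (proj₂ (proj₂ (proj₂ inner)))
  τa≡ : τ a ≡ σ a
  τa≡ = trans (P (m<n⇒m<1+n (acc< F)) (<⇒≢ (acc< F))) (update-other σ b (<⇒≢ (acc< F)))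
  τa≤ : size (τ a) ≤ z
  τa≤ = subst (λ t → size t ≤ z) (sym τa≡) acc≤z
  τb≤ : size (τ b) ≤ S + ⟪ growthᵖ g ⟫ z
  τb≤ = subst (λ t → size t ≤ S + ⟪ growthᵖ g ⟫ z) (sym (trans τb≡ (cong (⟦ g ⟧ᵍ ρ) σ₁b≡)))
    (≤-trans (size-gen g B (value ρ e)) (+-monoˡ-≤ _ (size-value B e)))
compile-correct (g ⨾ h) {a} {b} {xs} F {σ} {ρ} {z} H B acc≤z =
  let τ , t , run , (τa≡ , P) , t≤ = compile-correct g F H B acc≤z
      G = ⟪ growthᵖ g ⟫ z
      τa≤ = subst (λ acc → size acc ≤ z + G) (sym τa≡)
              (≤-trans (size-gen g B (σ a)) (+-monoˡ-≤ G acc≤z))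
      υ , u , run′ , (υa≡ , P′) , u≤ =
        compile-correct h F {τ} {ρ} {z + G} (holds-preserved {xs = xs} {ρ} F P H) (bounded-mono {ρ = ρ} (m≤m+n z G) B) τa≤
  in υ , _ , seq run run′ ,
     (trans υa≡ (cong (⟦ h ⟧ᵍ ρ) τa≡) , λ y<b y≢a → trans (P′ y<b y≢a) (P y<b y≢a)) ,
     +-mono-≤ t≤ u≤
compile-correct (ite e g h) {a} {b} {xs} F {σ} {ρ} {z} H B acc≤z
  with value ρ e | eval-compileEx {xs = xs} {ρ} H e
... | nil   | eval≡ =
  let τ , t , run , Q , t≤ = compile-correct h F H B acc≤z
  in τ , _ , ifFalse eval≡ run , Q ,
     +-mono-≤ (cost-compileEx {xs = xs} {ρ} H B e) (≤-trans t≤ (m≤n+m _ _))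
... | _ ∙ _ | eval≡ =
  let τ , t , run , Q , t≤ = compile-correct g F H B acc≤z
  in τ , _ , ifTrue eval≡ run , Q ,
     +-mono-≤ (cost-compileEx {xs = xs} {ρ} H B e) (≤-trans t≤ (m≤m+n _ _))
compile-correct (for e g) {a} {b} {xs} F {σ} {ρ} {z} H B acc≤z =
  let τ , t , run , (τa≡ , P) , t≤ =
        loop-correct g (compile-correct g) F {ρ} {S} {y} {y + S * G}
          (bounded-mono {ρ = ρ} (m≤m+n z S) B) (m≤n+m S z) (m≤m+n y (S * G))
          (value ρ e) {σ₁}
          (trans (update-same σ b) (eval-compileEx {xs = xs} {ρ} H e))
          (λ i → trans (update-other σ b (<⇒≢ (env< F i))) (H i))
          (size-value B e)
          (+-mono-≤ (≤-trans (subst (λ acc → size acc ≤ z) (sym σ₁a≡) acc≤z) (m≤m+n z S))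
                    (*-monoˡ-≤ G (≤-trans (len≤size (value ρ e)) (size-value B e))))
  in τ , _ , seq assign run ,
     (trans τa≡ (cong (overSuffixes (value ρ e) _) σ₁a≡) ,
      λ y<b y≢a → trans (P y<b y≢a) (preserves-scratch σ y<b y≢a)) ,
     +-mono-≤ (cost-compileEx {xs = xs} {ρ} H B e)
       (≤-trans t≤ (+-monoˡ-≤ 1 (*-monoˡ-≤ _ (≤-trans (len≤size (value ρ e)) (size-value B e)))))
  where
  S = ⟪ sizeᵖ e ⟫ z
  y = z + S
  G = ⟪ growthᵖ g ⟫ y
  σ₁ : Store
  σ₁ = σ [ b ↦ eval σ (compileEx xs e) ]
  σ₁a≡ : σ₁ a ≡ σ a
  σ₁a≡ = update-other σ b (<⇒≢ (acc< F))

program : Gen 1 → Command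
program g = 1 ≔ var 0 ⨾ 0 ≔ nil ⨾ compile 0 (1 ∷ []) 2 g

programTimeᵖ : Gen 1 → Poly
programTimeᵖ g = 𝕏 ⊕ (𝕂 1 ⊕ timeᵖ g ⊚ (𝕂 1 ⊕ 𝕏))

program-correct : ∀ g v → ∃[ t ] Run (program g) v (⟦ g ⟧ᵍ (v ∷ []) nil) t × t ≤ ⟪ programTimeᵖ g ⟫ (size v)
program-correct g v =
  let τ , t , run , (τa≡ , _) , t≤ =
        compile-correct g fresh {ρ = v ∷ []} {suc (size v)} (λ { zero → refl }) (λ { zero → n≤1+n _ }) (s≤s z≤n)
  in _ , (τ , seq assign (seq assign run) , τa≡) , +-monoʳ-≤ (size v) (s≤s t≤)
  where
  fresh : Fresh 0 (1 ∷ []) 2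
  fresh .acc<      = s≤s z≤n
  fresh .env< zero = s≤s (s≤s z≤n)
  fresh .acc∉ zero = λ ()

-- Counting in unary

nils : ℕ → Tree → Tree
nils zero    t = t
nils (suc n) t = nil ∙ nils n t

nils-+ : ∀ m n t → nils m (nils n t) ≡ nils (m + n) t
nils-+ zero    n t = refl
nils-+ (suc m) n t = cong (nil ∙_) (nils-+ m n t)

nils-nil : ∀ n → nils n nil ≡ unary n
nils-nil zero    = refl
nils-nil (suc n) = cong (nil ∙_) (nils-nil n)

len-unary : ∀ n → len (unary n) ≡ n
len-unary zero    = refl
len-unary (suc n) = cong suc (len-unary n)

emit : ∀ {m} → Ex m → Gen m
emit e = push e skip

overSuffixes-nils : ∀ {f c} → (∀ t acc → f t acc ≡ nils c acc) →
                    ∀ t acc → overSuffixes t f acc ≡ nils (len t * c) acc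
overSuffixes-nils f≡ nil acc = refl
overSuffixes-nils {f} {c} f≡ (l ∙ r) acc = begin
  overSuffixes r f (f (l ∙ r) acc)   ≡⟨ overSuffixes-nils f≡ r _ ⟩
  nils (len r * c) (f (l ∙ r) acc)   ≡⟨ cong (nils (len r * c)) (f≡ _ acc) ⟩
  nils (len r * c) (nils c acc)      ≡⟨ nils-+ (len r * c) c acc ⟩
  nils (len r * c + c) acc           ≡⟨ cong (λ n → nils n acc) (+-comm (len r * c) c) ⟩
  nils (len (l ∙ r) * c) acc         ∎
  where open ≡-Reasoning

emitLen : ∀ {m} → Ex m → Gen m
emitLen e = for e (emit nil)

emitLen-nils : ∀ {m} (e : Ex m) ρ acc → ⟦ emitLen e ⟧ᵍ ρ acc ≡ nils (len (value ρ e)) acc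
emitLen-nils e ρ acc = trans (overSuffixes-nils (λ _ _ → refl) (value ρ e) acc)
                             (cong (λ n → nils n acc) (*-identityʳ _))

constant : ∀ {m} → ℕ → Gen m
constant zero    = skip
constant (suc c) = emit nil ⨾ constant c

constant-nils : ∀ {m} c (ρ : Env m) acc → ⟦ constant c ⟧ᵍ ρ acc ≡ nils c acc
constant-nils zero    ρ acc = refl
constant-nils (suc c) ρ acc = begin
  ⟦ constant c ⟧ᵍ ρ (nil ∙ acc)  ≡⟨ constant-nils c ρ (nil ∙ acc) ⟩
  nils c (nils 1 acc)            ≡⟨ nils-+ c 1 acc ⟩
  nils (c + 1) acc               ≡⟨ cong (λ n → nils n acc) (+-comm c 1) ⟩
  nils (suc c) acc               ∎
  where open ≡-Reasoning

-- The functions bounding time and parameter in an FPT reduction must themselves be computable.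
-- Nested loops over a list with one extra entry write such a function out in unary.
power : ∀ {m} → ℕ → ℕ → Fin m → Gen m
power c zero    i = constant c
power c (suc d) i = for (cons nil (var i)) (power c d (suc i))

power-nils : ∀ {m} c d i (ρ : Env m) acc →
             ⟦ power c d i ⟧ᵍ ρ acc ≡ nils (suc (len (lookup ρ i)) ^ d * c) acc
power-nils c zero    i ρ acc = trans (constant-nils c ρ acc) (cong (λ n → nils n acc) (sym (*-identityˡ c)))
power-nils c (suc d) i ρ acc = trans
  (overSuffixes-nils (λ t → power-nils c d (suc i) (t ∷ ρ)) (nil ∙ lookup ρ i) acc)
  (cong (λ n → nils n acc) (sym (*-assoc (suc (len (lookup ρ i))) (suc (len (lookup ρ i)) ^ d) c)))

computable-power : ∀ c d → Computable (λ k → suc k ^ d * c)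
computable-power c d = program (power c d zero) , λ k →
  let t , (τ , run , out) , _ = program-correct (power c d zero) (unary k)
  in t , τ , run , trans out (trans (power-nils c d zero (unary k ∷ []) nil)
       (trans (nils-nil _) (cong (λ n → unary (suc n ^ d * c)) (len-unary k))))

-- From polynomial to FPT time bounds

size-unary : ∀ k → size (unary k) ≡ suc (k + k)
size-unary zero    = refl
size-unary (suc k) = trans (cong (2 +_) (size-unary k)) (cong (λ n → suc (suc n)) (sym (+-suc k k)))

1≤size : ∀ t → 1 ≤ size t
1≤size nil     = ≤-refl
1≤size (l ∙ r) = s≤s z≤n

-- A product, rather than a sum, lets the power in a polynomial bound split into a function of `k`
-- and a power of the size of the graph.
size-instance : ∀ t k → suc (size (t ∙ unary k)) ≤ suc k * 4 * size t
size-instance t k = begin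
  suc (suc (size t + size (unary k)))            ≡⟨ cong (λ n → suc (suc (size t + n))) (size-unary k) ⟩
  suc (suc (size t + suc (k + k)))               ≡⟨ cong (λ n → suc (suc n)) (+-suc (size t) (k + k)) ⟩
  3 + (size t + (k + k))                         ≡⟨ +-assoc 3 (size t) (k + k) ⟨
  3 + size t + (k + k)
    ≤⟨ +-mono-≤ (+-monoˡ-≤ (size t) (*-mono-≤ (≤-refl {3}) (1≤size t))) (≤-trans (≤-reflexive (sym (*-identityʳ (k + k)))) (*-mono-≤ double (1≤size t))) ⟩
  3 * size t + size t + k * 4 * size t
    ≡⟨ cong (_+ k * 4 * size t) (+-comm (3 * size t) (size t)) ⟩
  4 * size t + k * 4 * size t                    ≡⟨ *-distribʳ-+ (size t) 4 (k * 4) ⟨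
  suc k * 4 * size t                             ∎
  where
  open ≤-Reasoning
  double : k + k ≤ k * 4
  double = begin
    k + k        ≡⟨ cong (k +_) (+-identityʳ k) ⟨
    2 * k        ≤⟨ *-monoˡ-≤ k (s≤s (s≤s (z≤n {2}))) ⟩
    4 * k        ≡⟨ *-comm 4 k ⟩
    k * 4        ∎

instance-bound : ∀ c d v k {x} → x ≤ c * suc (size (v ∙ unary k)) ^ d → x ≤ suc k ^ d * (c * 4 ^ d) * size v ^ d
instance-bound c d v k {x} x≤ = begin
  x                                          ≤⟨ x≤ ⟩
  c * suc (size (v ∙ unary k)) ^ d           ≤⟨ *-monoʳ-≤ c (^-monoˡ-≤ d (size-instance v k)) ⟩
  c * (suc k * 4 * size v) ^ d               ≡⟨ cong (c *_) ([m*n]^d (suc k * 4) (size v) d) ⟩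
  c * ((suc k * 4) ^ d * size v ^ d)
    ≡⟨ cong (λ n → c * (n * size v ^ d)) ([m*n]^d (suc k) 4 d) ⟩
  c * (suc k ^ d * 4 ^ d * size v ^ d)       ≡⟨ *-assoc c (suc k ^ d * 4 ^ d) (size v ^ d) ⟨
  c * (suc k ^ d * 4 ^ d) * size v ^ d
    ≡⟨ cong (_* size v ^ d) (x∙yz≈y∙xz *-commutativeSemigroup c (suc k ^ d) (4 ^ d)) ⟩
  suc k ^ d * (c * 4 ^ d) * size v ^ d       ∎
  where open ≤-Reasoning

module _ (P Q : ParameterizedProblem) where
  open ParameterizedProblem

  reduction : ∀ (g : Gen 1) (h : ℕ → ℕ) c₀ d₀ → (∀ k → h k ≤ suc k ^ d₀ * c₀) → (f : Instance P → ℕ → Instance Q) →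
    (∀ x k → ⟦ g ⟧ᵍ ((encode P x ∙ unary k) ∷ []) nil ≡ encode Q (f x k) ∙ unary (h k)) →
    (∀ x k → Yes P x k ⇔ Yes Q (f x k) (h k)) →
    P ≤ᶠᵖᵗ Q
  reduction g h c₀ d₀ h-bound f f-correct f-yes =
    let c , d , bound = poly-bound (programTimeᵖ g) in
    program g , (λ k → suc k ^ d * (c * 4 ^ d)) , (λ k → suc k ^ d₀ * c₀) , d ,
    computable-power (c * 4 ^ d) d , computable-power c₀ d₀ , λ x k →
      let t , run , t≤ = program-correct g (encode P x ∙ unary k)
      in f x k , h k , t ,
         subst (λ out → Run (program g) (encode P x ∙ unary k) out t) (f-correct x k) run ,
         ≤-trans t≤ (instance-bound c d (encode P x) k (bound _)) , h-bound k , f-yes x k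

-- The digits of ℕᵇ are 1 and 2, least significant first, so that n ones
-- followed by the digits of X stand for 2ⁿ (X + 1) − 1.

ones : ℕ → ℕᵇ → ℕᵇ
ones zero    X = X
ones (suc n) X = 1+[2 ones n X ]

suc-ones : ∀ n X → suc (toℕ (ones n X)) ≡ 2 ^ n * suc (toℕ X)
suc-ones zero    X = sym (*-identityˡ _)
suc-ones (suc n) X = begin
  suc (suc (2 * toℕ (ones n X)))    ≡⟨ *-suc 2 (toℕ (ones n X)) ⟨
  2 * suc (toℕ (ones n X))          ≡⟨ cong (2 *_) (suc-ones n X) ⟩
  2 * (2 ^ n * suc (toℕ X))         ≡⟨ *-assoc 2 (2 ^ n) _ ⟨
  2 ^ suc n * suc (toℕ X)           ∎
  where open ≡-Reasoning

-- Interval endpoints and their comparison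

numerator : ℕᵇ → ℕ → ℕ
numerator X p = toℕ (ones (suc p) X)

-- The rational number X + 1 − 2⁻⁽ᵖ⁺¹⁾.

spot : ℕᵇ → ℕ → ℚᵘ
spot X p = mkℚᵘ (pos (numerator X p)) (pred (toℕ 2[1+ ones p zero ]))

encode-ones : ∀ n X → encodeℕᵇ (ones n X) ≡ nils n (encodeℕᵇ X)
encode-ones zero    X = refl
encode-ones (suc n) X = cong (nil ∙_) (encode-ones n X)

encode-spot : ∀ X p →
  encodeℚᵘ (spot X p) ≡
  (nil ∙ nil ∙ nils p (encodeℕᵇ X)) ∙ ((nil ∙ nil) ∙ nils p nil)
encode-spot X p = cong₂ (λ a b → (nil ∙ a) ∙ b)
  (trans (cong encodeℕᵇ (fromℕ-toℕ (ones (suc p) X))) (encode-ones (suc p) X))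
  (trans (cong encodeℕᵇ (fromℕ-toℕ 2[1+ ones p zero ])) (cong ((nil ∙ nil) ∙_) (encode-ones p zero)))

-- Numerators have the form `P * X` minus 1. Adding `P + Q` to both sides of a cross-multiplied
-- inequality cancels the two subtractions, so that everything stays in the natural numbers.
cross-lhs : ∀ {a} P Q X → suc a ≡ P * X → a * Q + (P + Q) ≡ P * Q * X + P
cross-lhs {a} P Q X a+1≡ = begin
  a * Q + (P + Q)    ≡⟨ shift a P Q ⟩
  suc a * Q + P      ≡⟨ cong (λ n → n * Q + P) a+1≡ ⟩
  P * X * Q + P      ≡⟨ commute P Q X ⟩
  P * Q * X + P      ∎
  where
  open ≡-Reasoning
  shift : ∀ a P Q → a * Q + (P + Q) ≡ suc a * Q + P
  shift = solve-∀
  commute : ∀ P Q X → P * X * Q + P ≡ P * Q * X + P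
  commute = solve-∀

cross-rhs : ∀ {b} P Q Y → suc b ≡ Q * Y → (b + Q) * P + (P + Q) ≡ P * Q * suc Y + Q
cross-rhs {b} P Q Y b+1≡ = begin
  (b + Q) * P + (P + Q)    ≡⟨ shift b P Q ⟩
  (suc b + Q) * P + Q      ≡⟨ cong (λ n → (n + Q) * P + Q) b+1≡ ⟩
  (Q * Y + Q) * P + Q      ≡⟨ commute P Q Y ⟩
  P * Q * suc Y + Q        ∎
  where
  open ≡-Reasoning
  shift : ∀ b P Q → (b + Q) * P + (P + Q) ≡ (suc b + Q) * P + Q
  shift = solve-∀
  commute : ∀ P Q Y → (Q * Y + Q) * P + Q ≡ P * Q * suc Y + Q
  commute = solve-∀

cross-zero : ∀ {b} P Q Y → suc b ≡ Q * Y → b * P + (P + Q) ≡ P * Q * Y + Q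
cross-zero {b} P Q Y b+1≡ = begin
  b * P + (P + Q)    ≡⟨ cong (λ n → b * P + n) (+-comm P Q) ⟩
  b * P + (Q + P)    ≡⟨ cross-lhs Q P Y b+1≡ ⟩
  Q * P * Y + Q      ≡⟨ cong (λ n → n * Y + Q) (*-comm Q P) ⟩
  P * Q * Y + Q      ∎
  where open ≡-Reasoning

suc-numerator : ∀ X p → suc (numerator X p) ≡ 2 ^ suc p * suc (toℕ X)
suc-numerator X p = suc-ones (suc p) X

denominator≡ : ∀ p → toℕ 2[1+ ones p zero ] ≡ 2 ^ suc p
denominator≡ p = cong (2 *_) (trans (suc-ones p zero) (*-identityʳ (2 ^ p)))

spot≤⁺ : ∀ {X Y} p q → numerator X p * 2 ^ suc q ≤ numerator Y q * 2 ^ suc p → spot X p ℚᵘ.≤ spot Y q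
spot≤⁺ {X} {Y} p q h = *≤* (subst₂ ℤ._≤_ (ℤ.pos-* (numerator X p) _) (ℤ.pos-* (numerator Y q) _)
  (+≤+ (subst₂ (λ m n → numerator X p * m ≤ numerator Y q * n) (sym (denominator≡ q)) (sym (denominator≡ p)) h)))

spot≤spot+1-rhs : ∀ X Y p q →
  ↥ (spot Y q ℚᵘ.+ 1ℚᵘ) ℤ.* ↧ spot X p ≡ pos ((numerator Y q + 2 ^ suc q) * 2 ^ suc p)
spot≤spot+1-rhs X Y p q = begin
  (pos n ℤ.* pos 1 ℤ.+ pos 1 ℤ.* pos Q) ℤ.* pos P
    ≡⟨ cong₂ (λ a b → (a ℤ.+ b) ℤ.* pos P) (ℤ.*-identityʳ (pos n)) (ℤ.*-identityˡ (pos Q)) ⟩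
  pos (n + Q) ℤ.* pos P
    ≡⟨ ℤ.pos-* (n + Q) P ⟨
  pos ((n + Q) * P)
    ≡⟨ cong₂ (λ a b → pos ((n + a) * b)) (denominator≡ q) (denominator≡ p) ⟩
  pos ((n + 2 ^ suc q) * 2 ^ suc p) ∎
  where
  open ≡-Reasoning
  n = numerator Y q
  P = toℕ 2[1+ ones p zero ]
  Q = toℕ 2[1+ ones q zero ]

spot≤spot+1-lhs : ∀ X Y p q →
  ↥ spot X p ℤ.* ↧ (spot Y q ℚᵘ.+ 1ℚᵘ) ≡ pos (numerator X p * 2 ^ suc q)
spot≤spot+1-lhs X Y p q = begin
  pos n ℤ.* pos (suc (pred (Q * 1)))
    ≡⟨ cong (λ d → pos n ℤ.* pos (suc (pred d))) (*-identityʳ Q) ⟩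
  pos n ℤ.* pos Q
    ≡⟨ ℤ.pos-* n Q ⟨
  pos (n * Q)
    ≡⟨ cong (λ d → pos (n * d)) (denominator≡ q) ⟩
  pos (n * 2 ^ suc q) ∎
  where
  open ≡-Reasoning
  n = numerator X p
  Q = toℕ 2[1+ ones q zero ]

spot≤spot+1⁺ : ∀ X Y p q → numerator X p * 2 ^ suc q ≤ (numerator Y q + 2 ^ suc q) * 2 ^ suc p → spot X p ℚᵘ.≤ spot Y q ℚᵘ.+ 1ℚᵘ
spot≤spot+1⁺ X Y p q h = *≤* (subst₂ ℤ._≤_ (sym (spot≤spot+1-lhs X Y p q)) (sym (spot≤spot+1-rhs X Y p q)) (+≤+ h))

spot≤spot+1⁻ : ∀ X Y p q → spot X p ℚᵘ.≤ spot Y q ℚᵘ.+ 1ℚᵘ → numerator X p * 2 ^ suc q ≤ (numerator Y q + 2 ^ suc q) * 2 ^ suc p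
spot≤spot+1⁻ X Y p q (*≤* h) = ℤ.drop‿+≤+ (subst₂ ℤ._≤_ (spot≤spot+1-lhs X Y p q) (spot≤spot+1-rhs X Y p q) h)

-- Displacements lie in the interval from 1/2 to below 1, so they matter only if the addresses
-- differ by exactly 1. In that case cancellation leaves `P ≤ Q`, a comparison of powers of 2.
spot-reach⁻ : ∀ {X Y p q} → spot X p ℚᵘ.≤ spot Y q ℚᵘ.+ 1ℚᵘ →
              toℕ X ≤ suc (toℕ Y) × (toℕ X ≡ suc (toℕ Y) → p ≤ q)
spot-reach⁻ {X} {Y} {p} {q} h = ≮⇒≥ far , near
  where
  open ≤-Reasoning
  P = 2 ^ suc p
  Q = 2 ^ suc q
  main : P * Q * suc (toℕ X) + P ≤ P * Q * suc (suc (toℕ Y)) + Q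
  main = begin
    P * Q * suc (toℕ X) + P                    ≡⟨ cross-lhs P Q (suc (toℕ X)) (suc-numerator X p) ⟨
    numerator X p * Q + (P + Q)                ≤⟨ +-monoˡ-≤ (P + Q) (spot≤spot+1⁻ X Y p q h) ⟩
    (numerator Y q + Q) * P + (P + Q)          ≡⟨ cross-rhs P Q (suc (toℕ Y)) (suc-numerator Y q) ⟩
    P * Q * suc (suc (toℕ Y)) + Q              ∎
  far : ¬ suc (toℕ Y) < toℕ X
  far Y<X = <-irrefl refl (begin-strict
    P * Q * suc (suc (toℕ Y)) + Q
      ≤⟨ +-monoʳ-≤ _ (≤-trans (≤-reflexive (sym (*-identityˡ Q))) (*-monoˡ-≤ Q (m^n>0 2 (suc p)))) ⟩
    P * Q * suc (suc (toℕ Y)) + P * Q              ≡⟨ +-comm _ (P * Q) ⟩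
    P * Q + P * Q * suc (suc (toℕ Y))              ≡⟨ *-suc (P * Q) (suc (suc (toℕ Y))) ⟨
    P * Q * suc (suc (suc (toℕ Y)))                ≤⟨ *-monoʳ-≤ (P * Q) (s≤s Y<X) ⟩
    P * Q * suc (toℕ X)                            <⟨ m<m+n _ (m^n>0 2 (suc p)) ⟩
    P * Q * suc (toℕ X) + P                        ≤⟨ main ⟩
    P * Q * suc (suc (toℕ Y)) + Q                  ∎)
  near : toℕ X ≡ suc (toℕ Y) → p ≤ q
  near X≡ = ≮⇒≥ λ q<p → <⇒≱ (^-monoʳ-< 2 (s≤s (s≤s z≤n)) (s≤s q<p)) (+-cancelˡ-≤ (P * Q * suc (suc (toℕ Y))) P Q
    (subst (λ x → P * Q * suc x + P ≤ P * Q * suc (suc (toℕ Y)) + Q) X≡ main))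

spot-reach⁺ : ∀ X Y p q → toℕ X ≡ suc (toℕ Y) → p ≤ q → spot X p ℚᵘ.≤ spot Y q ℚᵘ.+ 1ℚᵘ
spot-reach⁺ X Y p q X≡ p≤q = spot≤spot+1⁺ X Y p q (+-cancelʳ-≤ (P + Q) _ _ (begin
    numerator X p * Q + (P + Q)                ≡⟨ cross-lhs P Q (suc (toℕ X)) (suc-numerator X p) ⟩
    P * Q * suc (toℕ X) + P
      ≤⟨ +-mono-≤ (≤-reflexive (cong (λ x → P * Q * suc x) X≡)) (^-monoʳ-≤ 2 (s≤s p≤q)) ⟩
    P * Q * suc (suc (toℕ Y)) + Q              ≡⟨ cross-rhs P Q (suc (toℕ Y)) (suc-numerator Y q) ⟨
    (numerator Y q + Q) * P + (P + Q)          ∎))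
  where
  open ≤-Reasoning
  P = 2 ^ suc p
  Q = 2 ^ suc q

spot-mono : ∀ X Y p q → toℕ Y ≡ suc (toℕ X) → spot X p ℚᵘ.≤ spot Y q
spot-mono X Y p q Y≡ = spot≤⁺ {X} {Y} p q (+-cancelʳ-≤ (P + Q) _ _ (begin
    numerator X p * Q + (P + Q)                ≡⟨ cross-lhs P Q (suc (toℕ X)) (suc-numerator X p) ⟩
    P * Q * suc (toℕ X) + P
      ≤⟨ +-monoʳ-≤ _ (≤-trans (≤-reflexive (sym (*-identityʳ P))) (*-monoʳ-≤ P (m^n>0 2 (suc q)))) ⟩
    P * Q * suc (toℕ X) + P * Q
      ≡⟨ trans (+-comm _ (P * Q)) (sym (*-suc (P * Q) (suc (toℕ X)))) ⟩
    P * Q * suc (suc (toℕ X))                  ≤⟨ m≤m+n _ Q ⟩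
    P * Q * suc (suc (toℕ X)) + Q              ≡⟨ cong (λ y → P * Q * suc y + Q) Y≡ ⟨
    P * Q * suc (toℕ Y) + Q                    ≡⟨ cross-zero P Q (suc (toℕ Y)) (suc-numerator Y q) ⟨
    numerator Y q * P + (P + Q)                ∎))
  where
  open ≤-Reasoning
  P = 2 ^ suc p
  Q = 2 ^ suc q

-- The length of the part of a list of length n which starts at position x.

rank : ∀ {n} → Fin n → ℕ
rank {suc n} zero    = suc n
rank {suc n} (suc x) = rank x

rank≤n : ∀ {n} (x : Fin n) → rank x ≤ n
rank≤n zero    = ≤-refl
rank≤n (suc x) = m≤n⇒m≤1+n (rank≤n x)

rank-injective : ∀ {n} {x y : Fin n} → rank x ≡ rank y → x ≡ y
rank-injective {x = zero}  {zero}  _  = refl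
rank-injective {x = zero}  {suc y} eq = contradiction (subst (_≤ _) (sym eq) (rank≤n y)) 1+n≰n
rank-injective {x = suc x} {zero}  eq = contradiction (subst (_≤ _) eq (rank≤n x)) 1+n≰n
rank-injective {x = suc x} {suc y} eq = cong suc (rank-injective eq)

rank-positive : ∀ {n} (x : Fin n) → ¬ rank x ≤ pred (rank x)
rank-positive zero    = 1+n≰n
rank-positive (suc x) = rank-positive x

-- Addresses on a track

1+[2_]-injective : ∀ {X Y} → 1+[2 X ] ≡ 1+[2 Y ] → X ≡ Y
1+[2_]-injective refl = refl

2[1+_]-injective : ∀ {X Y} → 2[1+ X ] ≡ 2[1+ Y ] → X ≡ Y
2[1+_]-injective refl = refl

pairCode : ℕ → ℕ → ℕᵇ
pairCode i j = ones i 2[1+ ones j zero ]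

ones-injective : ∀ i j → ones i zero ≡ ones j zero → i ≡ j
ones-injective zero    zero    _  = refl
ones-injective (suc i) (suc j) eq = cong suc (ones-injective i j (1+[2_]-injective eq))

-- The digit 2 separates two runs of ones, so both lengths can be read off.
pairCode-injective : ∀ i j i′ j′ → pairCode i j ≡ pairCode i′ j′ → i ≡ i′ × j ≡ j′
pairCode-injective zero    j zero     j′ eq = refl , ones-injective j j′ (2[1+_]-injective eq)
pairCode-injective (suc i) j (suc i′) j′ eq with pairCode-injective i j i′ j′ (1+[2_]-injective eq)
... | refl , refl = refl , refl

data Slot : Set where
  below centre above apart : Slot

-- The three lowest digits select the slot and `h` supplies the higher ones. Three digits from 1 and
-- 2 amount to at least 7, which leaves room for `origin` and `aside` below. The values 7, 8, 9 make
-- `centre` a neighbour of `below` and `above`, while 11 is out of reach of all three.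
slot : Slot → ℕᵇ → ℕᵇ
slot below  h = 1+[2 1+[2 1+[2 h ] ] ]
slot centre h = 2[1+ 1+[2 1+[2 h ] ] ]
slot above  h = 1+[2 2[1+ 1+[2 h ] ] ]
slot apart  h = 1+[2 1+[2 2[1+ h ] ] ]

offset : Slot → ℕ
offset below  = 7
offset centre = 8
offset above  = 9
offset apart  = 11

toℕ-slot : ∀ s h → toℕ (slot s h) ≡ offset s + 8 * toℕ h
toℕ-slot below  h = lemma (toℕ h)
  where
  lemma : ∀ h → 1 + 2 * (1 + 2 * (1 + 2 * h)) ≡ 7 + 8 * h
  lemma = solve-∀
toℕ-slot centre h = lemma (toℕ h)
  where
  lemma : ∀ h → 2 * (1 + (1 + 2 * (1 + 2 * h))) ≡ 8 + 8 * h
  lemma = solve-∀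
toℕ-slot above  h = lemma (toℕ h)
  where
  lemma : ∀ h → 1 + 2 * (2 * (1 + (1 + 2 * h))) ≡ 9 + 8 * h
  lemma = solve-∀
toℕ-slot apart  h = lemma (toℕ h)
  where
  lemma : ∀ h → 1 + 2 * (1 + 2 * (2 * (1 + h))) ≡ 11 + 8 * h
  lemma = solve-∀

7≤offset : ∀ s → 7 ≤ offset s
7≤offset below  = ≤ᵇ⇒≤ 7 7 _
7≤offset centre = ≤ᵇ⇒≤ 7 8 _
7≤offset above  = ≤ᵇ⇒≤ 7 9 _
7≤offset apart  = ≤ᵇ⇒≤ 7 11 _

offset≤11 : ∀ s → offset s ≤ 11
offset≤11 below  = ≤ᵇ⇒≤ 7 11 _
offset≤11 centre = ≤ᵇ⇒≤ 8 11 _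
offset≤11 above  = ≤ᵇ⇒≤ 9 11 _
offset≤11 apart  = ≤ᵇ⇒≤ 11 11 _

-- Offsets range from 7 to 11, so slots with different `h` are at least 4 apart.
slot-separated : ∀ s s′ h h′ → offset s + 8 * h ≤ suc (offset s′ + 8 * h′) → h ≤ h′
slot-separated s s′ h h′ near = ≮⇒≥ λ h′<h → <-irrefl refl (begin-strict
  offset s + 8 * h             ≤⟨ near ⟩
  suc (offset s′ + 8 * h′)     ≤⟨ s≤s (+-monoˡ-≤ (8 * h′) (offset≤11 s′)) ⟩
  12 + 8 * h′                  <⟨ m≤n+m (13 + 8 * h′) 2 ⟩
  7 + (8 + 8 * h′)             ≡⟨ cong (7 +_) (*-suc 8 h′) ⟨
  7 + 8 * suc h′               ≤⟨ +-mono-≤ (7≤offset s) (*-monoʳ-≤ 8 h′<h) ⟩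
  offset s + 8 * h             ∎)
  where open ≤-Reasoning

-- The places where intervals are put on a track; every pair (i , j) has
-- four slots of its own.

data Place (k : ℕ) : Set where
  origin aside : Place k
  at           : Slot → Fin k → Fin k → Place k

address : ∀ {k} → Place k → ℕᵇ
address origin     = zero
address aside      = 1+[2 1+[2 zero ] ]
address (at s i j) = slot s (pairCode (rank i) (rank j))

-- The combinatorial content of an overlap. Displacements differ by less than 1, so they are
-- irrelevant at the same place; at neighbouring places the left interval must be displaced at least
-- as far as the right one.
data Meets {k} : Place k → ℕ → Place k → ℕ → Set where
  same         : ∀ {a p q} → Meets a p a q
  below-centre : ∀ {i j p q} → q ≤ p → Meets (at below i j) p (at centre i j) q
  centre-below : ∀ {i j p q} → p ≤ q → Meets (at centre i j) p (at below i j) q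
  centre-above : ∀ {i j p q} → q ≤ p → Meets (at centre i j) p (at above i j) q
  above-centre : ∀ {i j p q} → p ≤ q → Meets (at above i j) p (at centre i j) q

Overlap : ℚᵘ → ℚᵘ → Set
Overlap a b = ∃[ x ] (a ℚᵘ.≤ x × x ℚᵘ.≤ a ℚᵘ.+ 1ℚᵘ) × (b ℚᵘ.≤ x × x ℚᵘ.≤ b ℚᵘ.+ 1ℚᵘ)

overlap-refl : ∀ a → Overlap a a
overlap-refl a = a , (ℚᵘ.≤-refl , ℚᵘ.p≤p+q a 1ℚᵘ) , (ℚᵘ.≤-refl , ℚᵘ.p≤p+q a 1ℚᵘ)

overlap-sym : ∀ {a b} → Overlap a b → Overlap b a
overlap-sym (x , a∋x , b∋x) = x , b∋x , a∋x

overlap-next : ∀ X Y p q → toℕ Y ≡ suc (toℕ X) → q ≤ p → Overlap (spot X p) (spot Y q)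
-- The left endpoint of the right-hand interval is a common point.
overlap-next X Y p q Y≡ q≤p = spot Y q ,
  (spot-mono X Y p q Y≡ , spot-reach⁺ Y X q p Y≡ q≤p) ,
  (ℚᵘ.≤-refl , ℚᵘ.p≤p+q (spot Y q) 1ℚᵘ)

below-centre⁺ : ∀ {k} (i j : Fin k) {p q} → q ≤ p →
                Overlap (spot (address (at below i j)) p) (spot (address (at centre i j)) q)
below-centre⁺ i j {p} {q} = overlap-next (address (at below i j)) (address (at centre i j)) p q
  (trans (toℕ-slot centre h) (cong suc (sym (toℕ-slot below h))))
  where h = pairCode (rank i) (rank j)

centre-above⁺ : ∀ {k} (i j : Fin k) {p q} → q ≤ p →
                Overlap (spot (address (at centre i j)) p) (spot (address (at above i j)) q)
centre-above⁺ i j {p} {q} = overlap-next (address (at centre i j)) (address (at above i j)) p q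
  (trans (toℕ-slot above h) (cong suc (sym (toℕ-slot centre h))))
  where h = pairCode (rank i) (rank j)

-- What remains, for addresses `x`, `y` and ranks `p`, `q`, of the inequality between the left
-- endpoint of one interval and the right endpoint of the other. Overlap gives it in both
-- directions.
Reach : ℕ → ℕ → ℕ → ℕ → Set
Reach x p y q = x ≤ suc y × (x ≡ suc y → p ≤ q)

slots-meet : ∀ {k} s s′ (i j : Fin k) {p q} n → Reach (offset s + n) p (offset s′ + n) q →
             Reach (offset s′ + n) q (offset s + n) p → Meets (at s i j) p (at s′ i j) q
slots-meet below  below  i j n _ _ = same
slots-meet centre centre i j n _ _ = same
slots-meet above  above  i j n _ _ = same
slots-meet apart  apart  i j n _ _ = same
slots-meet below  centre i j n _ (_ , q≤p) = below-centre (q≤p refl)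
slots-meet centre below  i j n (_ , p≤q) _ = centre-below (p≤q refl)
slots-meet centre above  i j n _ (_ , q≤p) = centre-above (q≤p refl)
slots-meet above  centre i j n (_ , p≤q) _ = above-centre (p≤q refl)
-- From here on the offsets differ by at least 2, against `far`.
slots-meet below  above  i j n _ (far , _) = ⊥-elim (≤⇒≤ᵇ (+-cancelʳ-≤ n 9 8 far))
slots-meet above  below  i j n (far , _) _ = ⊥-elim (≤⇒≤ᵇ (+-cancelʳ-≤ n 9 8 far))
slots-meet below  apart  i j n _ (far , _) = ⊥-elim (≤⇒≤ᵇ (+-cancelʳ-≤ n 11 8 far))
slots-meet apart  below  i j n (far , _) _ = ⊥-elim (≤⇒≤ᵇ (+-cancelʳ-≤ n 11 8 far))
slots-meet centre apart  i j n _ (far , _) = ⊥-elim (≤⇒≤ᵇ (+-cancelʳ-≤ n 11 9 far))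
slots-meet apart  centre i j n (far , _) _ = ⊥-elim (≤⇒≤ᵇ (+-cancelʳ-≤ n 11 9 far))
slots-meet above  apart  i j n _ (far , _) = ⊥-elim (≤⇒≤ᵇ (+-cancelʳ-≤ n 11 10 far))
slots-meet apart  above  i j n (far , _) _ = ⊥-elim (≤⇒≤ᵇ (+-cancelʳ-≤ n 11 10 far))

slot-not-low : ∀ s h n → n < 6 → ¬ toℕ (slot s h) ≤ suc n
slot-not-low s h n n<6 low = <⇒≱ (s≤s n<6) (begin
  7                        ≤⟨ 7≤offset s ⟩
  offset s                 ≤⟨ m≤m+n (offset s) _ ⟩
  offset s + 8 * toℕ h     ≡⟨ toℕ-slot s h ⟨
  toℕ (slot s h)           ≤⟨ low ⟩
  suc n                    ∎)
  where open ≤-Reasoning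

at-meet : ∀ {k} s s′ (i j i′ j′ : Fin k) {p q} → i ≡ i′ → j ≡ j′ →
  let n = 8 * toℕ (pairCode (rank i) (rank j)); n′ = 8 * toℕ (pairCode (rank i′) (rank j′)) in
  Reach (offset s + n) p (offset s′ + n′) q → Reach (offset s′ + n′) q (offset s + n) p →
  Meets (at s i j) p (at s′ i′ j′) q
at-meet s s′ i j _ _ refl refl = slots-meet s s′ i j _

reach-subst : ∀ {x x′ y y′ p q} → x ≡ x′ → y ≡ y′ → Reach x p y q → Reach x′ p y′ q
reach-subst refl refl r = r

places-meet : ∀ {k} (a b : Place k) {p q} → Reach (toℕ (address a)) p (toℕ (address b)) q →
              Reach (toℕ (address b)) q (toℕ (address a)) p → Meets a p b q
places-meet origin origin _ _ = same
places-meet aside  aside  _ _ = same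
places-meet origin aside  _ (far , _) = ⊥-elim (≤⇒≤ᵇ far)
places-meet aside  origin (far , _) _ = ⊥-elim (≤⇒≤ᵇ far)
places-meet origin (at s i j) _ (far , _) = contradiction far (slot-not-low s _ 0 (≤ᵇ⇒≤ 1 6 _))
places-meet aside  (at s i j) _ (far , _) = contradiction far (slot-not-low s _ 3 (≤ᵇ⇒≤ 4 6 _))
places-meet (at s i j) origin (far , _) _ = contradiction far (slot-not-low s _ 0 (≤ᵇ⇒≤ 1 6 _))
places-meet (at s i j) aside  (far , _) _ = contradiction far (slot-not-low s _ 3 (≤ᵇ⇒≤ 4 6 _))
places-meet (at s i j) (at s′ i′ j′) r r′ =
  at-meet s s′ i j i′ j′ (rank-injective (proj₁ ranks≡)) (rank-injective (proj₂ ranks≡)) reach reach′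
  where
  h  = pairCode (rank i) (rank j)
  h′ = pairCode (rank i′) (rank j′)
  reach  = reach-subst (toℕ-slot s h) (toℕ-slot s′ h′) r
  reach′ = reach-subst (toℕ-slot s′ h′) (toℕ-slot s h) r′
  ranks≡ : rank i ≡ rank i′ × rank j ≡ rank j′
  ranks≡ = pairCode-injective (rank i) (rank j) (rank i′) (rank j′) (toℕ-injective (≤-antisym
    (slot-separated s s′ _ _ (proj₁ reach)) (slot-separated s′ s _ _ (proj₁ reach′))))

overlap⇒meets : ∀ {k} (a b : Place k) {p q} →
                Overlap (spot (address a) p) (spot (address b) q) → Meets a p b q
overlap⇒meets a b (x , (a≤x , x≤a+1) , (b≤x , x≤b+1)) = places-meet a b
  (spot-reach⁻ (ℚᵘ.≤-trans a≤x x≤b+1)) (spot-reach⁻ (ℚᵘ.≤-trans b≤x x≤a+1))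

-- Cardinalities of subsets of Fin n

injection⇒≤∣∣ : ∀ {m n} (f : Fin m → Fin n) (D : Subset n) →
                Injective _≡_ _≡_ f → (∀ i → f i ∈ D) → m ≤ ∣ D ∣
injection⇒≤∣∣ {zero}  f D f-inj f∈D = z≤n
injection⇒≤∣∣ {suc m} f D f-inj f∈D = <-≤-trans
  (s≤s (injection⇒≤∣∣ (f ∘ suc) (D - f zero) (Fin.suc-injective ∘ f-inj)
    (λ i → x∈p∧x≢y⇒x∈p-y (f∈D (suc i)) (λ eq → case f-inj eq of λ ()))))
  (x∈p⇒∣p-x∣<∣p∣ (f∈D zero))

-- Pigeonhole: an element of `D` that is missed could be added to the injection, giving `suc m`
-- elements in a set of size `m`.
injection-covers : ∀ {m n} (f : Fin m → Fin n) (D : Subset n) →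
                   Injective _≡_ _≡_ f → (∀ i → f i ∈ D) → ∣ D ∣ ≡ m →
                   ∀ {x} → x ∈ D → ∃[ i ] f i ≡ x
injection-covers {m} f D f-inj f∈D ∣D∣≡m {x} x∈D with any? (λ i → f i Fin.≟ x)
... | yes found = found
... | no ¬found = contradiction (≤-trans (injection⇒≤∣∣ g D g-inj g∈D) (≤-reflexive ∣D∣≡m)) 1+n≰n
  where
  g : Fin (suc m) → _
  g zero    = x
  g (suc i) = f i
  g-inj : Injective _≡_ _≡_ g
  g-inj {zero}  {zero}  _  = refl
  g-inj {zero}  {suc i} eq = contradiction (i , sym eq) ¬found
  g-inj {suc i} {zero}  eq = contradiction (i , eq) ¬found
  g-inj {suc i} {suc j} eq = cong suc (f-inj eq)
  g∈D : ∀ i → g i ∈ D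
  g∈D zero    = x∈D
  g∈D (suc i) = f∈D i

enumerate : ∀ {n} (D : Subset n) →
            ∃[ f ] Injective _≡_ _≡_ f × (∀ (i : Fin ∣ D ∣) → f i ∈ D)
enumerate [] = (λ ()) , (λ {i} → case i of λ ()) , λ ()
enumerate (outside ∷ D) =
  let f , f-inj , f∈D = enumerate D
  in suc ∘ f , f-inj ∘ Fin.suc-injective , λ i → there (f∈D i)
enumerate {suc n} (inside ∷ D) = g , g-inj , g∈D
  where
  f = proj₁ (enumerate D)
  g : Fin (suc ∣ D ∣) → Fin (suc n)
  g zero    = zero
  g (suc i) = suc (f i)
  g-inj : Injective _≡_ _≡_ g
  g-inj {zero}  {zero}  _  = refl
  g-inj {suc i} {suc j} eq = cong suc (proj₁ (proj₂ (enumerate D)) (Fin.suc-injective eq))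
  g∈D : ∀ i → g i ∈ inside ∷ D
  g∈D zero    = here
  g∈D (suc i) = there (proj₂ (proj₂ (enumerate D)) i)

image : ∀ {m n} → (Fin m → Fin n) → Subset n
image {zero}  f = ⊥
image {suc m} f = ⁅ f zero ⁆ ∪ image (f ∘ suc)

∈-image⁺ : ∀ {m n} (f : Fin m → Fin n) i → f i ∈ image f
∈-image⁺ f zero    = x∈p∪q⁺ (inj₁ (x∈⁅x⁆ (f zero)))
∈-image⁺ f (suc i) = x∈p∪q⁺ {p = ⁅ f zero ⁆} (inj₂ (∈-image⁺ (f ∘ suc) i))

∈-image⁻ : ∀ {m n} (f : Fin m → Fin n) {x} → x ∈ image f → ∃[ i ] f i ≡ x
∈-image⁻ {zero}  f x∈ = contradiction x∈ ∉⊥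
∈-image⁻ {suc m} f x∈ with x∈p∪q⁻ ⁅ f zero ⁆ (image (f ∘ suc)) x∈
... | inj₁ x∈⁅⁆ = zero , sym (x∈⁅y⁆⇒x≡y (f zero) x∈⁅⁆)
... | inj₂ x∈′  = let i , eq = ∈-image⁻ (f ∘ suc) x∈′ in suc i , eq

∣image∣ : ∀ {m n} (f : Fin m → Fin n) → Injective _≡_ _≡_ f → ∣ image f ∣ ≡ m
∣image∣ f f-inj = ≤-antisym (injective⇒≤ h-inj) (injection⇒≤∣∣ f (image f) f-inj (∈-image⁺ f))
  where
  e = proj₁ (enumerate (image f))
  pre : ∀ i → ∃[ j ] f j ≡ e i
  pre i = ∈-image⁻ f (proj₂ (proj₂ (enumerate (image f))) i)
  h-inj : Injective _≡_ _≡_ (proj₁ ∘ pre)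
  h-inj {i} {j} eq = proj₁ (proj₂ (enumerate (image f)))
    (trans (sym (proj₂ (pre i))) (trans (cong f eq) (proj₂ (pre j))))

-- Lists indexed by Fin n, in descending order

module _ {A : Set} where

  listFor : ∀ n → (Fin n → List A) → List A
  listFor zero    f = []
  listFor (suc n) f = listFor n (f ∘ suc) ++ f zero

  -- These mirror loops over a suffix and over its tail. The order is descending because what is
  -- pushed first ends up last.
  listFrom listAfter : ∀ {n} → Fin n → (Fin n → List A) → List A
  listFrom {suc n} zero    f = listFor (suc n) f
  listFrom         (suc x) f = listFrom x (f ∘ suc)
  listAfter {suc n} zero    f = listFor n (f ∘ suc)
  listAfter         (suc x) f = listAfter x (f ∘ suc)

  ∈-listFor : ∀ {n a} f (x : Fin n) → a ∈ˡ f x → a ∈ˡ listFor n f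
  ∈-listFor f zero    a∈ = ∈-++⁺ʳ (listFor _ (f ∘ suc)) a∈
  ∈-listFor f (suc x) a∈ = ∈-++⁺ˡ (∈-listFor (f ∘ suc) x a∈)

  ∈-listFrom : ∀ {n a} f {x y : Fin n} → x Fin.≤ y → a ∈ˡ f y → a ∈ˡ listFrom x f
  ∈-listFrom f {zero}          x≤y       a∈ = ∈-listFor f _ a∈
  ∈-listFrom f {suc x} {suc y} (s≤s x≤y) a∈ = ∈-listFrom (f ∘ suc) x≤y a∈

  ∈-listAfter : ∀ {n a} f {x y : Fin n} → x Fin.< y → a ∈ˡ f y → a ∈ˡ listAfter x f
  ∈-listAfter f {zero}  {suc y} x<y       a∈ = ∈-listFor (f ∘ suc) y a∈
  ∈-listAfter f {suc x} {suc y} (s≤s x<y) a∈ = ∈-listAfter (f ∘ suc) x<y a∈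

  All-listFor : ∀ {P : A → Set} n f → (∀ x → All P (f x)) → All P (listFor n f)
  All-listFor zero    f h = []
  All-listFor (suc n) f h = ++⁺ (All-listFor n (f ∘ suc) (h ∘ suc)) (h zero)

  All-listFrom : ∀ {P : A → Set} {n} (x : Fin n) f → (∀ y → x Fin.≤ y → All P (f y)) → All P (listFrom x f)
  All-listFrom {n = suc n} zero f h = All-listFor (suc n) f (λ y → h y z≤n)
  All-listFrom (suc x) f h = All-listFrom x (f ∘ suc) (λ y x≤y → h (suc y) (s≤s x≤y))

  All-listAfter : ∀ {P : A → Set} {n} (x : Fin n) f → (∀ y → All P (f y)) → All P (listAfter x f)
  All-listAfter {n = suc n} zero f h = All-listFor n (f ∘ suc) (h ∘ suc)
  All-listAfter (suc x) f h = All-listAfter x (f ∘ suc) (h ∘ suc)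

n≰pred[m]⇒m≤n : ∀ {m n} → ¬ n ≤ pred m → m ≤ n
n≰pred[m]⇒m≤n {zero}  _ = z≤n
n≰pred[m]⇒m≤n {suc m} h = ≰⇒> h

-- The gadgets

module Construction (k n : ℕ) (E : Fin n → Fin n → Bool) where

  -- A candidate (i , j , u , v) asserts that the i-th and the j-th vertex of
  -- the clique are u and v; vetoed stands for a candidate ruled out because u
  -- and v are not adjacent.  The tests of i, j, l and s rule out rank v < rank u
  -- and rank u < rank v for selected candidates (i , j , u , _) and
  -- (l , i , _ , v).

  data Item : Set where
    candidate       : Fin k → Fin k → Fin n → Fin n → Item
    vetoed          : Fin k → Fin k → Item
    guard₁ guard₂   : Fin k → Fin k → Item
    test₁ test₂     : Fin k → Fin k → Fin k → Fin n → Item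

  -- A guard is displaced by `n`, the largest rank, and so meets every candidate of its pair. Ranks
  -- start at 1, hence `pred (rank s)` turns a threshold into a strict one: `test₁` meets a
  -- candidate `(i , j , u , _)` iff `rank u < rank s`, and `(l , i , _ , v)` iff `rank s ≤ rank v`.
  -- The place `aside` keeps the tests away from the candidates on the first track.
  placement : Item → Vec (Place k × ℕ) 3
  placement (candidate i j u v) = (origin , 0)       ∷ (at centre i j , rank u)        ∷ (at centre i j , rank v) ∷ []
  placement (vetoed i j)        = (origin , 0)       ∷ (origin , 0)                    ∷ (origin , 0) ∷ []
  placement (guard₁ i j)        = (at below i j , 0) ∷ (at below i j , n)             ∷ (at apart i j , 0) ∷ []
  placement (guard₂ i j)        = (at above i j , 0) ∷ (at apart i j , 0)             ∷ (at below i j , n) ∷ []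
  placement (test₁ i j l s)     = (aside , 0)        ∷ (at below i j , pred (rank s))  ∷ (at above l i , rank s) ∷ []
  placement (test₂ i j l s)     = (aside , 0)        ∷ (at above i j , rank s)         ∷ (at below l i , pred (rank s)) ∷ []

  spotAt : Place k × ℕ → ℚᵘ
  spotAt (b , p) = spot (address b) p

  interval : Item → Unit3TrackInterval
  interval a = Vec.map spotAt (placement a)

  Touches : Item → Item → Set
  Touches a b = ∃[ t ] Overlap (lookup (interval a) t) (lookup (interval b) t)

  MeetsOn : Fin 3 → Item → Item → Set
  MeetsOn t a b = Meets (proj₁ (lookup (placement a) t)) (proj₂ (lookup (placement a) t))
                        (proj₁ (lookup (placement b) t)) (proj₂ (lookup (placement b) t))

  touches⇒meets : ∀ a b → Touches a b → ∃[ t ] MeetsOn t a b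
  touches⇒meets a b (t , o) = t , overlap⇒meets _ _
    (subst₂ Overlap (lookup-map t _ (placement a)) (lookup-map t _ (placement b)) o)

  -- Chosen so that whatever meets a guard has the owner of that guard; neighbourhoods of guards of
  -- different pairs are thus disjoint. On the third track `test₂ i j l s` shares the place of
  -- `guard₂ l i`, which explains its owner.
  owner : Item → Fin k × Fin k
  owner (candidate i j _ _) = i , j
  owner (vetoed i j)        = i , j
  owner (guard₁ i j)        = i , j
  owner (guard₂ i j)        = i , j
  owner (test₁ i j _ _)     = i , j
  owner (test₂ i _ l _)     = l , i

  -- Case analysis is done on MeetsOn, not on Touches, whose rational
  -- endpoints are expensive to normalise.

  MeetsSome : Item → Item → Set
  MeetsSome a b = ∃[ t ] MeetsOn t a b

  guard₁-owner : ∀ {i j} b → MeetsSome (guard₁ i j) b → owner b ≡ (i , j)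
  guard₁-owner (candidate _ _ _ _) (1F , below-centre _) = refl
  guard₁-owner (guard₁ _ _)        (0F , same)           = refl
  guard₁-owner (guard₁ _ _)        (1F , same)           = refl
  guard₁-owner (guard₁ _ _)        (2F , same)           = refl
  guard₁-owner (test₁ _ _ _ _)     (1F , same)           = refl

  guard₂-owner : ∀ {i j} b → MeetsSome (guard₂ i j) b → owner b ≡ (i , j)
  guard₂-owner (candidate _ _ _ _) (2F , below-centre _) = refl
  guard₂-owner (guard₂ _ _)        (0F , same)           = refl
  guard₂-owner (guard₂ _ _)        (1F , same)           = refl
  guard₂-owner (guard₂ _ _)        (2F , same)           = refl
  guard₂-owner (test₂ _ _ _ _)     (2F , same)           = refl

  -- Each guard alone is also met by itself and by tests. But the guards of a pair occupy different
  -- slots on every track, and no test meets guards of both kinds.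
  guards-candidate : ∀ {i j} b → MeetsSome (guard₁ i j) b → MeetsSome (guard₂ i j) b →
                     ∃[ u ] ∃[ v ] b ≡ candidate i j u v
  guards-candidate (candidate _ _ u v) (1F , below-centre _) _ = u , v , refl
  guards-candidate (candidate _ _ u v) (2F , ()) _
  guards-candidate (guard₂ _ _)    (0F , ()) _
  guards-candidate (guard₂ _ _)    (1F , ()) _
  guards-candidate (guard₂ _ _)    (2F , ()) _
  guards-candidate (test₂ _ _ _ _) (0F , ()) _
  guards-candidate (test₂ _ _ _ _) (1F , ()) _
  guards-candidate (test₂ _ _ _ _) (2F , ()) _
  guards-candidate (guard₁ _ _)    _ (0F , ())
  guards-candidate (guard₁ _ _)    _ (1F , ())
  guards-candidate (guard₁ _ _)    _ (2F , ())
  guards-candidate (test₁ _ _ _ _) _ (0F , ())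
  guards-candidate (test₁ _ _ _ _) _ (1F , ())
  guards-candidate (test₁ _ _ _ _) _ (2F , ())

  -- The decisive threshold is `U i j` itself: on the second track the test would need a rank
  -- strictly below it, so it is met on the third.
  test₁-agree : ∀ (U V : Fin k → Fin k → Fin n) {i j l i′ j′} →
    MeetsSome (test₁ i j l (U i j)) (candidate i′ j′ (U i′ j′) (V i′ j′)) → rank (U i j) ≤ rank (V l i)
  test₁-agree U V {i} {j} (1F , below-centre U<U) = contradiction U<U (rank-positive (U i j))
  test₁-agree U V         (2F , above-centre U≤V) = U≤V

  test₂-agree : ∀ (U V : Fin k → Fin k → Fin n) {i j l i′ j′} →
    MeetsSome (test₂ i j l (V l i)) (candidate i′ j′ (U i′ j′) (V i′ j′)) → rank (V l i) ≤ rank (U i j)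
  test₂-agree U V             (1F , above-centre V≤U) = V≤U
  test₂-agree U V {i} {l = l} (2F , below-centre V<V) = contradiction V<V (rank-positive (V l i))

  -- The pairs with `i < j` and those with `j ≤ i` are listed separately, each with an inner loop
  -- that starts at a suffix of the outer one. A vetoed item in place of a forbidden candidate meets
  -- no guard.
  items₁ items₂ guards tests items : List Item
  items₁ = listFor k λ i → listAfter i λ j → listFor n λ u → listFor n λ v →
    (if E u v then candidate i j u v else vetoed i j) ∷ []
  items₂ = listFor k λ j → listFrom j λ i → listFor n λ u → listFor n λ v → candidate i j u v ∷ []
  guards = listFor k λ i → listFor k λ j → guard₁ i j ∷ guard₂ i j ∷ []
  tests  = listFor k λ i → listFor k λ j → listFor k λ l → listFor n λ s → test₁ i j l s ∷ test₂ i j l s ∷ []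
  items  = tests ++ guards ++ items₂ ++ items₁

  -- Nothing is demanded for `j < i`, where symmetry of G suffices, nor for `i = j`, where the tests
  -- force both coordinates to be the same vertex.
  Sound : Item → Set
  Sound (candidate i j u v) = i Fin.< j → E u v ≡ true
  Sound _                   = ⊤

  items-sound : All Sound items
  items-sound = ++⁺ tests-sound (++⁺ guards-sound (++⁺ items₂-sound items₁-sound))
    where
    tests-sound : All Sound tests
    tests-sound = All-listFor k _ λ i → All-listFor k _ λ j → All-listFor k _ λ l → All-listFor n _ λ s → tt ∷ tt ∷ []
    guards-sound : All Sound guards
    guards-sound = All-listFor k _ λ i → All-listFor k _ λ j → tt ∷ tt ∷ []
    items₂-sound : All Sound items₂
    items₂-sound = All-listFor k _ λ j → All-listFrom j _ λ i j≤i → All-listFor n _ λ u → All-listFor n _ λ v →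
      (λ i<j → contradiction j≤i (<⇒≱ i<j)) ∷ []
    items₁-sound : All Sound items₁
    items₁-sound = All-listFor k _ λ i → All-listAfter i _ λ j → All-listFor n _ λ u → All-listFor n _ λ v →
      sound i j u v ∷ []
      where
      sound : ∀ i j u v → Sound (if E u v then candidate i j u v else vetoed i j)
      sound i j u v with E u v in uv
      ... | true  = λ _ → uv
      ... | false = tt

  test₁∈items : ∀ i j l s → test₁ i j l s ∈ˡ items
  test₁∈items i j l s = ∈-++⁺ˡ (∈-listFor _ i (∈-listFor _ j (∈-listFor _ l (∈-listFor _ s (here refl)))))

  test₂∈items : ∀ i j l s → test₂ i j l s ∈ˡ items
  test₂∈items i j l s = ∈-++⁺ˡ (∈-listFor _ i (∈-listFor _ j (∈-listFor _ l (∈-listFor _ s (there (here refl))))))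

  guard₁∈items : ∀ i j → guard₁ i j ∈ˡ items
  guard₁∈items i j = ∈-++⁺ʳ tests (∈-++⁺ˡ (∈-listFor _ i (∈-listFor _ j (here refl))))

  guard₂∈items : ∀ i j → guard₂ i j ∈ˡ items
  guard₂∈items i j = ∈-++⁺ʳ tests (∈-++⁺ˡ (∈-listFor _ i (∈-listFor _ j (there (here refl)))))

  candidate∈items : ∀ i j u v → (i Fin.< j → E u v ≡ true) → candidate i j u v ∈ˡ items
  candidate∈items i j u v ok with i Fin.<? j
  ... | yes i<j = ∈-++⁺ʳ tests (∈-++⁺ʳ guards (∈-++⁺ʳ items₂
    (∈-listFor _ i (∈-listAfter _ i<j (∈-listFor _ u (∈-listFor _ v
      (here (sym (cong (λ b → if b then candidate i j u v else vetoed i j) (ok i<j))))))))))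
  ... | no  i≮j = ∈-++⁺ʳ tests (∈-++⁺ʳ guards (∈-++⁺ˡ
    (∈-listFor _ j (∈-listFrom _ (≮⇒≥ i≮j) (∈-listFor _ u (∈-listFor _ v (here refl)))))))

  representation : Unit3TrackRepresentation
  representation = record { members = Vec.map interval (Vec.fromList items) }

  H : Graph
  H = Unit3TrackRepresentation.graph representation

  open Graph H using (Adj) renaming (order to N)

  item : Fin N → Item
  item = lookup (Vec.fromList items)

  interval≡ : ∀ x → lookup (Unit3TrackRepresentation.members representation) x ≡ interval (item x)
  interval≡ x = lookup-map x interval (Vec.fromList items)

  adj⇒touches : ∀ {x y} → Adj x y → Touches (item x) (item y)
  adj⇒touches {x} {y} (_ , (t , z) , zx , zy) = t , z ,
    subst (λ I → ⟦ I ⟧ (t , z)) (interval≡ x) zx , subst (λ I → ⟦ I ⟧ (t , z)) (interval≡ y) zy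

  touches⇒adj : ∀ {x y} → x ≢ y → Touches (item x) (item y) → Adj x y
  touches⇒adj {x} {y} x≢y (t , z , zx , zy) = x≢y , (t , z) ,
    subst (λ I → ⟦ I ⟧ (t , z)) (sym (interval≡ x)) zx , subst (λ I → ⟦ I ⟧ (t , z)) (sym (interval≡ y)) zy

  item-sound : ∀ x → Sound (item x)
  item-sound = go items-sound
    where
    go : ∀ {as} → All Sound as → ∀ x → Sound (lookup (Vec.fromList as) x)
    go (p ∷ ps) zero    = p
    go (p ∷ ps) (suc x) = go ps x

  position : ∀ {a} → a ∈ˡ items → ∃[ x ] item x ≡ a
  position = go items
    where
    go : ∀ as {a} → a ∈ˡ as → ∃[ x ] lookup (Vec.fromList as) x ≡ a
    go (_ ∷ as) (here a≡)  = zero , sym a≡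
    go (_ ∷ as) (there a∈) = let x , eq = go as a∈ in suc x , eq

  -- Completeness: cliques of G give dominating cliques

  module FromClique (w : Fin k → Fin n) (w-adj : ∀ {i j : Fin k} → i ≢ j → E (w i) (w j) ≡ true) where

    chosen : Fin k → Fin k → Item
    chosen i j = candidate i j (w i) (w j)

    chosen∈items : ∀ i j → chosen i j ∈ˡ items
    chosen∈items i j = candidate∈items i j (w i) (w j) (λ i<j → w-adj (Fin.<⇒≢ i<j))

    chosenAt : Fin k × Fin k → Fin N
    chosenAt (i , j) = proj₁ (position (chosen∈items i j))

    item-chosenAt : ∀ i j → item (chosenAt (i , j)) ≡ chosen i j
    item-chosenAt i j = proj₂ (position (chosen∈items i j))

    touches-chosen : ∀ a → ∃[ i ] ∃[ j ] Touches a (chosen i j)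
    touches-chosen (candidate i j _ _) = i , j , 0F , overlap-refl _
    touches-chosen (vetoed i j)        = i , j , 0F , overlap-refl _
    touches-chosen (guard₁ i j)        = i , j , 1F , below-centre⁺ i j (rank≤n (w i))
    touches-chosen (guard₂ i j)        = i , j , 2F , below-centre⁺ i j (rank≤n (w j))
    -- Both `chosen i j`, in its first coordinate, and `chosen l i`, in its second, carry `w i`, and
    -- every vertex is on one of the two sides of the threshold.
    touches-chosen (test₁ i j l s) = case rank (w i) ≤? pred (rank s) of λ where
      (yes low) → i , j , 1F , below-centre⁺ i j low
      (no ¬low) → l , i , 2F , overlap-sym (centre-above⁺ l i {rank (w i)} {rank s} (n≰pred[m]⇒m≤n ¬low))
    touches-chosen (test₂ i j l s) = case rank (w i) ≤? pred (rank s) of λ where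
      (yes low) → l , i , 2F , below-centre⁺ l i low
      (no ¬low) → i , j , 1F , overlap-sym (centre-above⁺ i j {rank (w i)} {rank s} (n≰pred[m]⇒m≤n ¬low))

    member : Fin (k * k) → Fin N
    member c = chosenAt (remQuot {k} k c)

    member-injective : Injective _≡_ _≡_ member
    member-injective {c} {d} eq = begin
      c                                          ≡⟨ Fin.combine-remQuot {k} k c ⟨
      uncurry combine (remQuot {k} k c)                 ≡⟨ cong (uncurry combine) remQuot≡ ⟩
      uncurry combine (remQuot {k} k d)                 ≡⟨ Fin.combine-remQuot {k} k d ⟩
      d                                          ∎
      where
      open ≡-Reasoning
      owner-member : ∀ c → owner (item (member c)) ≡ remQuot {k} k c
      owner-member c = cong owner (item-chosenAt (proj₁ (remQuot {k} k c)) (proj₂ (remQuot {k} k c)))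
      remQuot≡ : remQuot {k} k c ≡ remQuot {k} k d
      remQuot≡ = trans (sym (owner-member c)) (trans (cong (owner ∘ item) eq) (owner-member d))

    D : Subset N
    D = image member

    chosenAt∈D : ∀ i j → chosenAt (i , j) ∈ D
    chosenAt∈D i j = subst (λ c → chosenAt c ∈ D) (Fin.remQuot-combine i j) (∈-image⁺ member (combine i j))

    D-dominating : IsDominating H D
    D-dominating x =
      let i , j , touch = touches-chosen (item x)
          y = chosenAt (i , j)
      in case x Fin.≟ y of λ where
        (yes x≡y) → inj₁ (subst (_∈ D) (sym x≡y) (chosenAt∈D i j))
        (no  x≢y) → inj₂ (y , chosenAt∈D i j , touches⇒adj x≢y (subst (Touches (item x)) (sym (item-chosenAt i j)) touch))

    D-clique : IsClique H D
    D-clique x∈D y∈D x≢y =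
      let c , x≡ = ∈-image⁻ member x∈D
          d , y≡ = ∈-image⁻ member y∈D
          item-x = trans (cong item (sym x≡)) (item-chosenAt (proj₁ (remQuot {k} k c)) (proj₂ (remQuot {k} k c)))
          item-y = trans (cong item (sym y≡)) (item-chosenAt (proj₁ (remQuot {k} k d)) (proj₂ (remQuot {k} k d)))
      in touches⇒adj x≢y (subst₂ Touches (sym item-x) (sym item-y) (0F , overlap-refl _))

    hasDominatingClique : HasDominatingClique H (k * k)
    hasDominatingClique = D , ∣image∣ member member-injective , D-dominating , D-clique

  -- Soundness: dominating sets of the given size give cliques of G

  module FromDominating (D : Subset N) (∣D∣≡ : ∣ D ∣ ≡ k * k) (D-dominating : IsDominating H D) where

    dominated : ∀ {a} → a ∈ˡ items → ∃[ y ] y ∈ D × MeetsSome a (item y)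
    dominated a∈ with position a∈
    -- A vertex of `D` dominates itself; it shares its place with itself on any track.
    ... | x , refl = [ (λ x∈D → x , x∈D , 0F , same) ,
                       (λ (y , y∈D , xy) → y , y∈D , touches⇒meets (item x) (item y) (adj⇒touches xy)) ]′ (D-dominating x)

    dominator : Fin k × Fin k → Fin N
    dominator (i , j) = proj₁ (dominated (guard₁∈items i j))

    owner-dominator : ∀ c → owner (item (dominator c)) ≡ c
    owner-dominator (i , j) = guard₁-owner _ (proj₂ (proj₂ (dominated (guard₁∈items i j))))

    -- Distinct pairs have distinct dominators, so these exhaust D.

    dominators-exhaust : ∀ {y} → y ∈ D → ∃[ c ] dominator c ≡ y
    dominators-exhaust y∈D =
      let c , eq = injection-covers (dominator ∘ remQuot {k} k) D injective
                     (λ c → proj₁ (proj₂ (dominated (guard₁∈items (proj₁ (remQuot {k} k c)) (proj₂ (remQuot {k} k c)))))) ∣D∣≡ y∈D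
      in remQuot {k} k c , eq
      where
      injective : Injective _≡_ _≡_ (dominator ∘ remQuot {k} k)
      injective {c} {d} eq = trans (sym (Fin.combine-remQuot {k} k c))
        (trans (cong (uncurry combine) (trans (sym (owner-dominator _)) (trans (cong (owner ∘ item) eq) (owner-dominator _))))
               (Fin.combine-remQuot {k} k d))

    -- The vertex dominating `guard₂ i j` is the dominator of some pair, and comparing owners shows
    -- that the pair is `(i , j)`. One vertex therefore meets both guards.
    choice : ∀ i j → ∃[ u ] ∃[ v ] item (dominator (i , j)) ≡ candidate i j u v
    choice i j =
      let y , y∈D , meets₂ = dominated (guard₂∈items i j)
          c , eq = dominators-exhaust y∈D
          c≡ij = trans (sym (owner-dominator c)) (trans (cong (owner ∘ item) eq) (guard₂-owner (item y) meets₂))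
      in guards-candidate _ (proj₂ (proj₂ (dominated (guard₁∈items i j))))
           (subst (λ z → MeetsSome (guard₂ i j) (item z)) (trans (sym eq) (cong dominator c≡ij)) meets₂)

    U V : Fin k → Fin k → Fin n
    U i j = proj₁ (choice i j)
    V i j = proj₁ (proj₂ (choice i j))

    dominated′ : ∀ {a} → a ∈ˡ items → ∃[ i ] ∃[ j ] MeetsSome a (candidate i j (U i j) (V i j))
    dominated′ {a} a∈ =
      let y , y∈D , meets = dominated a∈
          (i , j) , eq = dominators-exhaust y∈D
      in i , j , subst (MeetsSome a) (trans (cong item (sym eq)) (proj₂ (proj₂ (choice i j)))) meets

    U≤V : ∀ i j l → rank (U i j) ≤ rank (V l i)
    U≤V i j l = test₁-agree U V (proj₂ (proj₂ (dominated′ (test₁∈items i j l (U i j)))))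

    V≤U : ∀ i j l → rank (V l i) ≤ rank (U i j)
    V≤U i j l = test₂-agree U V (proj₂ (proj₂ (dominated′ (test₂∈items i j l (V l i)))))

    U≡V : ∀ i j l → U i j ≡ V l i
    U≡V i j l = rank-injective (≤-antisym (U≤V i j l) (V≤U i j l))

    w : Fin k → Fin n
    w i = U i i

    w-adj : ∀ {i j} → i Fin.< j → E (w i) (w j) ≡ true
    -- `U i j ≡ V i i ≡ U i i` and `V i j ≡ U j j` move the edge of the candidate for `(i , j)` to
    -- the diagonal.
    w-adj {i} {j} i<j = subst₂ (λ u v → E u v ≡ true)
      (trans (U≡V i j i) (sym (U≡V i i i))) (sym (U≡V j j i))
      (subst Sound (proj₂ (proj₂ (choice i j))) (item-sound (dominator (i , j))) i<j)

module _ (G : InputGraph) {k : ℕ} where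
  open InputGraph G

  -- Irreflexivity makes `w` injective: a repeated vertex would be adjacent to itself. Hence the
  -- image has `k` elements.
  increasing-clique : (w : Fin k → Fin order) → (∀ {i j} → i Fin.< j → matrix (w i) (w j) ≡ true) → HasClique (toGraph G) k
  increasing-clique w w-adj = image w , ∣image∣ w w-inj , clique
    where
    adj : ∀ {i j} → i ≢ j → matrix (w i) (w j) ≡ true
    adj {i} {j} i≢j with Fin.<-cmp i j
    ... | tri< i<j _ _ = w-adj i<j
    ... | tri≈ _ i≡j _ = contradiction i≡j i≢j
    ... | tri> _ _ j<i = trans (symm (w i) (w j)) (w-adj j<i)
    w-inj : Injective _≡_ _≡_ w
    w-inj {i} {j} eq with i Fin.≟ j
    ... | yes i≡j = i≡j
    ... | no  i≢j = case trans (sym (irrefl (w j))) (trans (cong (λ u → matrix u (w j)) (sym eq)) (adj i≢j)) of λ ()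
    clique : IsClique (toGraph G) (image w)
    clique u∈ v∈ u≢v with ∈-image⁻ w u∈ | ∈-image⁻ w v∈
    ... | i , refl | j , refl = adj (λ i≡j → u≢v (cong w i≡j))

module _ (G : InputGraph) (k : ℕ) where
  open InputGraph G
  open Construction k order matrix

  clique⇒dominatingClique : HasClique (toGraph G) k → HasDominatingClique H (k * k)
  clique⇒dominatingClique (C , refl , C-clique) =
    let w , w-inj , w∈C = enumerate C
    in FromClique.hasDominatingClique w (λ {i} {j} i≢j → C-clique (w∈C i) (w∈C j) (i≢j ∘ w-inj))

  dominating⇒clique : ∀ {D} → ∣ D ∣ ≡ k * k → IsDominating H D → HasClique (toGraph G) k
  dominating⇒clique {D} ∣D∣≡ D-dominating = increasing-clique G w w-adj
    where open FromDominating D ∣D∣≡ D-dominating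

clique⇒connected : ∀ (H : Graph) {D} → IsClique H D → IsConnected H D
clique⇒connected H D-clique {x} {y} x∈D y∈D with x Fin.≟ y
... | yes refl = ε
... | no  x≢y  = (x∈D , y∈D , D-clique x∈D y∈D x≢y) ◅ ε

-- Loops over encoded vectors

tuple : ∀ n → (Fin n → Tree) → Tree
tuple zero    f = nil
tuple (suc n) f = f zero ∙ tuple n (f ∘ suc)

suffix : ∀ {n} → (Fin n → Tree) → Fin n → Tree
suffix {suc n} f zero    = tuple (suc n) f
suffix         f (suc x) = suffix (f ∘ suc) x

tuple-cong : ∀ n {f g} → (∀ x → f x ≡ g x) → tuple n f ≡ tuple n g
tuple-cong zero    f≡g = refl
tuple-cong (suc n) f≡g = cong₂ _∙_ (f≡g zero) (tuple-cong n (f≡g ∘ suc))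

encodeVec-tabulate : ∀ {A : Set} (enc : A → Tree) n (f : Fin n → A) → encodeVec enc (tabulate f) ≡ tuple n (enc ∘ f)
encodeVec-tabulate enc zero    f = refl
encodeVec-tabulate enc (suc n) f = cong (enc (f zero) ∙_) (encodeVec-tabulate enc n (f ∘ suc))

unary-tuple : ∀ n → unary n ≡ tuple n (λ _ → nil)
unary-tuple zero    = refl
unary-tuple (suc n) = cong (nil ∙_) (unary-tuple n)

len-tuple : ∀ n f → len (tuple n f) ≡ n
len-tuple zero    f = refl
len-tuple (suc n) f = cong suc (len-tuple n (f ∘ suc))

len-suffix : ∀ {n} f (x : Fin n) → len (suffix f x) ≡ rank x
len-suffix {suc n} f zero    = len-tuple (suc n) f
len-suffix         f (suc x) = len-suffix (f ∘ suc) x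

len-right : ∀ t → len (right t) ≡ pred (len t)
len-right nil     = refl
len-right (l ∙ r) = refl

left-suffix : ∀ {n} f (x : Fin n) → left (suffix f x) ≡ f x
left-suffix f zero    = refl
left-suffix f (suc x) = left-suffix (f ∘ suc) x

module _ {A : Set} (enc : A → Tree) where

  prepend : List A → Tree → Tree
  prepend as t = foldr (λ a → enc a ∙_) t as

  prepend-++ : ∀ as bs t → prepend (as ++ bs) t ≡ prepend as (prepend bs t)
  prepend-++ as bs t = foldr-++ (λ a → enc a ∙_) t as bs

  overSuffixes-listFor : ∀ n f {h : Tree → Tree → Tree} (L : Fin n → List A) →
    (∀ x acc → h (suffix f x) acc ≡ prepend (L x) acc) →
    ∀ acc → overSuffixes (tuple n f) h acc ≡ prepend (listFor n L) acc
  overSuffixes-listFor zero    f     L h≡ acc = refl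
  overSuffixes-listFor (suc n) f {h} L h≡ acc = begin
    overSuffixes (tuple n (f ∘ suc)) h (h (tuple (suc n) f) acc)
      ≡⟨ overSuffixes-listFor n (f ∘ suc) (L ∘ suc) (h≡ ∘ suc) _ ⟩
    prepend (listFor n (L ∘ suc)) (h (tuple (suc n) f) acc)
      ≡⟨ cong (prepend (listFor n (L ∘ suc))) (h≡ zero acc) ⟩
    prepend (listFor n (L ∘ suc)) (prepend (L zero) acc)
      ≡⟨ prepend-++ (listFor n (L ∘ suc)) (L zero) acc ⟨
    prepend (listFor (suc n) L) acc                               ∎
    where open ≡-Reasoning

  overSuffixes-listFrom : ∀ {n} (x : Fin n) f {h : Tree → Tree → Tree} (L : Fin n → List A) →
    (∀ y acc → h (suffix f y) acc ≡ prepend (L y) acc) →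
    ∀ acc → overSuffixes (suffix f x) h acc ≡ prepend (listFrom x L) acc
  overSuffixes-listFrom {suc n} zero    f L h≡ acc = overSuffixes-listFor (suc n) f L h≡ acc
  overSuffixes-listFrom         (suc x) f L h≡ acc = overSuffixes-listFrom x (f ∘ suc) (L ∘ suc) (h≡ ∘ suc) acc

  overSuffixes-listAfter : ∀ {n} (x : Fin n) f {h : Tree → Tree → Tree} (L : Fin n → List A) →
    (∀ y acc → h (suffix f y) acc ≡ prepend (L y) acc) →
    ∀ acc → overSuffixes (right (suffix f x)) h acc ≡ prepend (listAfter x L) acc
  overSuffixes-listAfter {suc n} zero    f L h≡ acc = overSuffixes-listFor n (f ∘ suc) (L ∘ suc) (h≡ ∘ suc) acc
  overSuffixes-listAfter         (suc x) f L h≡ acc = overSuffixes-listAfter x (f ∘ suc) (L ∘ suc) (h≡ ∘ suc) acc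

  encodeVec-fromList : ∀ {B : Set} (f : B → A) bs →
    encodeVec enc (Vec.map f (Vec.fromList bs)) ≡ foldr (λ b → enc (f b) ∙_) nil bs
  encodeVec-fromList f []       = refl
  encodeVec-fromList f (b ∷ bs) = cong (enc (f b) ∙_) (encodeVec-fromList f bs)

-- Generators for the encodings of intervals

data PlaceEx (m : ℕ) : Set where
  origin aside : PlaceEx m
  at           : Slot → Ex m → Ex m → PlaceEx m

one two : ∀ {m} → Gen m
one = emit nil
two = emit (cons nil nil)

-- Pushing reverses the order: the most significant digit comes first.

slotGen : ∀ {m} → Slot → Gen m
slotGen below  = one ⨾ one ⨾ one
slotGen centre = one ⨾ one ⨾ two
slotGen above  = one ⨾ two ⨾ one
slotGen apart  = two ⨾ one ⨾ one

addressGen : ∀ {m} → PlaceEx m → Gen m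
addressGen origin     = skip
addressGen aside      = one ⨾ one
addressGen (at s i j) = emitLen j ⨾ two ⨾ emitLen i ⨾ slotGen s

-- The denominator is written first and the numerator pushed onto it, which forms the pair. Of the
-- two final `one`s the first is the last of the `p + 1` digits 1, the second is the sign: the digit
-- 1 and the sign of a non-negative integer are both encoded by `nil`.
spotGen : ∀ {m} → PlaceEx m × Ex m → Gen m
spotGen (b , p) = push nil (emitLen p ⨾ two ⨾ push nil (addressGen b ⨾ emitLen p ⨾ one ⨾ one))

spotsGen : ∀ {m l} → Vec (PlaceEx m × Ex m) l → Gen m
spotsGen []       = skip
spotsGen (b ∷ bs) = spotsGen bs ⨾ spotGen b

module _ {m : ℕ} (ρ : Env m) where

  addressOf : PlaceEx m → ℕᵇ
  addressOf origin     = zero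
  addressOf aside      = 1+[2 1+[2 zero ] ]
  addressOf (at s i j) = slot s (pairCode (len (value ρ i)) (len (value ρ j)))

  spotOf : PlaceEx m × Ex m → _
  spotOf (b , p) = spot (addressOf b) (len (value ρ p))

  slotGen-correct : ∀ s h → ⟦ slotGen s ⟧ᵍ ρ (encodeℕᵇ h) ≡ encodeℕᵇ (slot s h)
  slotGen-correct below  h = refl
  slotGen-correct centre h = refl
  slotGen-correct above  h = refl
  slotGen-correct apart  h = refl

  addressGen-correct : ∀ b → ⟦ addressGen b ⟧ᵍ ρ nil ≡ encodeℕᵇ (addressOf b)
  addressGen-correct origin     = refl
  addressGen-correct aside      = refl
  addressGen-correct (at s i j) = trans (cong (⟦ slotGen s ⟧ᵍ ρ) code≡) (slotGen-correct s _)
    where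
    a = len (value ρ i)
    b = len (value ρ j)
    code≡ : ⟦ emitLen j ⨾ two ⨾ emitLen i ⟧ᵍ ρ nil ≡ encodeℕᵇ (pairCode a b)
    code≡ = begin
      ⟦ emitLen i ⟧ᵍ ρ ((nil ∙ nil) ∙ ⟦ emitLen j ⟧ᵍ ρ nil)   ≡⟨ emitLen-nils i ρ _ ⟩
      nils a ((nil ∙ nil) ∙ ⟦ emitLen j ⟧ᵍ ρ nil)
        ≡⟨ cong (λ t → nils a ((nil ∙ nil) ∙ t)) (trans (emitLen-nils j ρ nil) (sym (encode-ones b zero))) ⟩
      nils a (encodeℕᵇ 2[1+ ones b zero ])                    ≡⟨ encode-ones a 2[1+ ones b zero ] ⟨
      encodeℕᵇ (pairCode a b)                                 ∎
      where open ≡-Reasoning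

  spotGen-correct : ∀ bp acc → ⟦ spotGen bp ⟧ᵍ ρ acc ≡ encodeℚᵘ (spotOf bp) ∙ acc
  spotGen-correct (b , p) acc = cong (_∙ acc) (begin
    (nil ∙ nil ∙ ⟦ emitLen p ⟧ᵍ ρ (⟦ addressGen b ⟧ᵍ ρ nil)) ∙ ((nil ∙ nil) ∙ ⟦ emitLen p ⟧ᵍ ρ nil)
      ≡⟨ cong₂ (λ s t → (nil ∙ nil ∙ s) ∙ ((nil ∙ nil) ∙ t))
           (trans (emitLen-nils p ρ _) (cong (nils (len (value ρ p))) (addressGen-correct b)))
           (emitLen-nils p ρ nil) ⟩
    (nil ∙ nil ∙ nils (len (value ρ p)) (encodeℕᵇ (addressOf b))) ∙ ((nil ∙ nil) ∙ nils (len (value ρ p)) nil)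
      ≡⟨ encode-spot (addressOf b) (len (value ρ p)) ⟨
    encodeℚᵘ (spotOf (b , p)) ∎)
    where open ≡-Reasoning

  spotsGen-correct : ∀ {l} (bs : Vec (PlaceEx m × Ex m) l) →
                     ⟦ spotsGen bs ⟧ᵍ ρ nil ≡ encodeVec encodeℚᵘ (Vec.map spotOf bs)
  spotsGen-correct []       = refl
  spotsGen-correct (b ∷ bs) = trans (spotGen-correct b _) (cong (encodeℚᵘ (spotOf b) ∙_) (spotsGen-correct bs))

Spots : ℕ → Set
Spots m = Vec (PlaceEx m × Ex m) 3

itemGen : ∀ {m} → Spots m → Gen m
itemGen bs = push nil (spotsGen bs)

vetoedSpots : ∀ {m} → Spots m
vetoedSpots = (origin , nil) ∷ (origin , nil) ∷ (origin , nil) ∷ []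

guard₁Spots guard₂Spots : ∀ {m} → Ex m → Ex m → Ex m → Spots m
guard₁Spots i j n = (at below i j , nil) ∷ (at below i j , n) ∷ (at apart i j , nil) ∷ []
guard₂Spots i j n = (at above i j , nil) ∷ (at apart i j , nil) ∷ (at below i j , n) ∷ []

candidateSpots test₁Spots test₂Spots : ∀ {m} → Ex m → Ex m → Ex m → Ex m → Spots m
candidateSpots i j u v = (origin , nil) ∷ (at centre i j , u) ∷ (at centre i j , v) ∷ []
test₁Spots i j l s     = (aside , nil) ∷ (at below i j , tl s) ∷ (at above l i , s) ∷ []
test₂Spots i j l s     = (aside , nil) ∷ (at above i j , s) ∷ (at below l i , tl s) ∷ []

-- The head of the input is the matrix, its tail the unary parameter. A suffix of the matrix counts
-- `u`, and its head is the row of `u`; a suffix of that row counts `v`, and its head is the matrix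
-- entry.
items₁Gen items₂Gen guardsGen testsGen reductionGen : Gen 1
items₁Gen = for (tl (var 0F)) (for (tl (var 0F)) (for (hd (var 2F)) (for (hd (var 0F))
  (ite (hd (var 0F)) (itemGen (candidateSpots (var 3F) (var 2F) (var 1F) (var 0F))) (itemGen vetoedSpots)))))
items₂Gen = for (tl (var 0F)) (for (var 0F) (for (hd (var 2F)) (for (hd (var 0F))
  (itemGen (candidateSpots (var 2F) (var 3F) (var 1F) (var 0F))))))
guardsGen = for (tl (var 0F)) (for (tl (var 1F))
  (itemGen (guard₂Spots (var 1F) (var 0F) (hd (var 2F))) ⨾ itemGen (guard₁Spots (var 1F) (var 0F) (hd (var 2F)))))
testsGen = for (tl (var 0F)) (for (tl (var 1F)) (for (tl (var 2F)) (for (hd (var 3F))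
  (itemGen (test₂Spots (var 3F) (var 2F) (var 1F) (var 0F)) ⨾ itemGen (test₁Spots (var 3F) (var 2F) (var 1F) (var 0F))))))
-- The new parameter `k * k` comes first, since pushing the representation onto it yields the
-- required pair.
reductionGen =
  for (tl (var 0F)) (for (tl (var 1F)) (emit nil)) ⨾
  push nil (items₁Gen ⨾ items₂Gen ⨾ guardsGen ⨾ testsGen)

-- Correctness of the generated instance

module _ (k n : ℕ) (E : Fin n → Fin n → Bool) where
  open Construction k n E

  bits : Fin n → Fin n → Tree
  bits u v = encodeBool (E u v)

  rows counters : Tree
  rows     = tuple n (λ u → tuple n (bits u))
  counters = tuple k (λ _ → nil)

  input : Tree
  input = rows ∙ counters

  encodeItem : Item → Tree
  encodeItem a = encodeVec encodeℚᵘ (interval a)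

  emits : List Item → Tree → Tree
  emits = prepend encodeItem

  -- Only the lengths of the values matter, so rows, cells and counters can all serve as numbers.
  data Denotes {m} (ρ : Env m) : PlaceEx m × Ex m → Place k × ℕ → Set where
    origin : Denotes ρ (origin , nil) (origin , 0)
    aside  : Denotes ρ (aside , nil) (aside , 0)
    at     : ∀ {s eᵢ eⱼ eₚ i j p} →
             len (value ρ eᵢ) ≡ rank i → len (value ρ eⱼ) ≡ rank j → len (value ρ eₚ) ≡ p →
             Denotes ρ (at s eᵢ eⱼ , eₚ) (at s i j , p)

  module _ {m : ℕ} (ρ : Env m) where

    spotOf≡spotAt : ∀ {b b′} → Denotes ρ b b′ → spotOf ρ b ≡ spotAt b′
    spotOf≡spotAt origin = refl
    spotOf≡spotAt aside  = refl
    spotOf≡spotAt (at {s} i≡ j≡ p≡) = cong₂ spot (cong₂ (λ a b → slot s (pairCode a b)) i≡ j≡) p≡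

    map-spotOf≡ : ∀ {l} {bs : Vec _ l} {bs′ : Vec _ l} → Pointwise (Denotes ρ) bs bs′ → Vec.map (spotOf ρ) bs ≡ Vec.map spotAt bs′
    map-spotOf≡ []        = refl
    map-spotOf≡ (d ∷ ds) = cong₂ _∷_ (spotOf≡spotAt d) (map-spotOf≡ ds)

    itemGen-correct : ∀ a bs → Pointwise (Denotes ρ) bs (placement a) →
                      ∀ acc → ⟦ itemGen bs ⟧ᵍ ρ acc ≡ encodeItem a ∙ acc
    itemGen-correct a bs ds acc = cong (_∙ acc) (trans (spotsGen-correct ρ bs) (cong (encodeVec encodeℚᵘ) (map-spotOf≡ ds)))

    pred-len : ∀ e {p} → len (value ρ e) ≡ p → len (value ρ (tl e)) ≡ pred p
    pred-len e e≡ = trans (len-right (value ρ e)) (cong pred e≡)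

    vetoedGen-correct : ∀ i j acc → ⟦ itemGen vetoedSpots ⟧ᵍ ρ acc ≡ encodeItem (vetoed i j) ∙ acc
    vetoedGen-correct i j = itemGen-correct (vetoed i j) vetoedSpots (origin ∷ origin ∷ origin ∷ [])

    module _ (eᵢ eⱼ : Ex m) {i j : Fin k} (i≡ : len (value ρ eᵢ) ≡ rank i) (j≡ : len (value ρ eⱼ) ≡ rank j) where

      candidateGen-correct : ∀ eᵤ eᵥ {u v} → len (value ρ eᵤ) ≡ rank u → len (value ρ eᵥ) ≡ rank v →
        ∀ acc → ⟦ itemGen (candidateSpots eᵢ eⱼ eᵤ eᵥ) ⟧ᵍ ρ acc ≡ encodeItem (candidate i j u v) ∙ acc
      candidateGen-correct eᵤ eᵥ {u} {v} u≡ v≡ =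
        itemGen-correct (candidate i j u v) (candidateSpots eᵢ eⱼ eᵤ eᵥ) (origin ∷ at i≡ j≡ u≡ ∷ at i≡ j≡ v≡ ∷ [])

      guard₁Gen-correct : ∀ eₙ → len (value ρ eₙ) ≡ n →
        ∀ acc → ⟦ itemGen (guard₁Spots eᵢ eⱼ eₙ) ⟧ᵍ ρ acc ≡ encodeItem (guard₁ i j) ∙ acc
      guard₁Gen-correct eₙ n≡ =
        itemGen-correct (guard₁ i j) (guard₁Spots eᵢ eⱼ eₙ) (at i≡ j≡ refl ∷ at i≡ j≡ n≡ ∷ at i≡ j≡ refl ∷ [])

      guard₂Gen-correct : ∀ eₙ → len (value ρ eₙ) ≡ n →
        ∀ acc → ⟦ itemGen (guard₂Spots eᵢ eⱼ eₙ) ⟧ᵍ ρ acc ≡ encodeItem (guard₂ i j) ∙ acc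
      guard₂Gen-correct eₙ n≡ =
        itemGen-correct (guard₂ i j) (guard₂Spots eᵢ eⱼ eₙ) (at i≡ j≡ refl ∷ at i≡ j≡ refl ∷ at i≡ j≡ n≡ ∷ [])

      test₁Gen-correct : ∀ eₗ eₛ {l s} → len (value ρ eₗ) ≡ rank l → len (value ρ eₛ) ≡ rank s →
        ∀ acc → ⟦ itemGen (test₁Spots eᵢ eⱼ eₗ eₛ) ⟧ᵍ ρ acc ≡ encodeItem (test₁ i j l s) ∙ acc
      test₁Gen-correct eₗ eₛ {l} {s} l≡ s≡ =
        itemGen-correct (test₁ i j l s) (test₁Spots eᵢ eⱼ eₗ eₛ) (aside ∷ at i≡ j≡ (pred-len eₛ s≡) ∷ at l≡ i≡ s≡ ∷ [])

      test₂Gen-correct : ∀ eₗ eₛ {l s} → len (value ρ eₗ) ≡ rank l → len (value ρ eₛ) ≡ rank s →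
        ∀ acc → ⟦ itemGen (test₂Spots eᵢ eⱼ eₗ eₛ) ⟧ᵍ ρ acc ≡ encodeItem (test₂ i j l s) ∙ acc
      test₂Gen-correct eₗ eₛ {l} {s} l≡ s≡ =
        itemGen-correct (test₂ i j l s) (test₂Spots eᵢ eⱼ eₗ eₛ) (aside ∷ at i≡ j≡ s≡ ∷ at l≡ i≡ (pred-len eₛ s≡) ∷ [])

  counter : Fin k → Tree
  counter = suffix (λ _ → nil)

  row : Fin n → Tree
  row = suffix (λ u → tuple n (bits u))

  cell : Fin n → Fin n → Tree
  cell u = suffix (bits u)

  counter-rank : ∀ i → len (counter i) ≡ rank i
  counter-rank = len-suffix _

  row-rank : ∀ u → len (row u) ≡ rank u
  row-rank = len-suffix _

  cell-rank : ∀ u v → len (cell u v) ≡ rank v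
  cell-rank u = len-suffix (bits u)

  overRow : ∀ u {h : Tree → Tree → Tree} (L : Fin n → List Item) →
    (∀ v acc → h (cell u v) acc ≡ emits (L v) acc) →
    ∀ acc → overSuffixes (left (row u)) h acc ≡ emits (listFor n L) acc
  overRow u L h≡ acc = trans (cong (λ t → overSuffixes t _ acc) (left-suffix _ u))
    (overSuffixes-listFor encodeItem n (bits u) L h≡ acc)

  items₁Gen-correct : ∀ acc → ⟦ items₁Gen ⟧ᵍ (input ∷ []) acc ≡ emits items₁ acc
  items₁Gen-correct = overSuffixes-listFor encodeItem k _ _ λ i →
    overSuffixes-listAfter encodeItem i _ _ λ j →
    overSuffixes-listFor encodeItem n _ _ λ u →
    overRow u _ λ v → cell-correct i j u v
    where
    cell-correct : ∀ i j u v acc →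
      ⟦ ite (hd (var 0F)) (itemGen (candidateSpots (var 3F) (var 2F) (var 1F) (var 0F))) (itemGen vetoedSpots) ⟧ᵍ
        (cell u v ∷ row u ∷ counter j ∷ counter i ∷ input ∷ []) acc ≡
      emits ((if E u v then candidate i j u v else vetoed i j) ∷ []) acc
    cell-correct i j u v acc = go (left (cell u v)) (left-suffix (bits u) v)
      where
      ρ = cell u v ∷ row u ∷ counter j ∷ counter i ∷ input ∷ []
      -- `left (cell u v)` does not compute for a variable `v`, so the tree that is tested is
      -- generalised before the case distinction on `E u v`.
      go : ∀ t → t ≡ bits u v →
        branch t (⟦ itemGen (candidateSpots (var 3F) (var 2F) (var 1F) (var 0F)) ⟧ᵍ ρ acc) (⟦ itemGen vetoedSpots ⟧ᵍ ρ acc) ≡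
        emits ((if E u v then candidate i j u v else vetoed i j) ∷ []) acc
      go _ refl with E u v
      ... | true  = candidateGen-correct ρ (var 3F) (var 2F) (counter-rank i) (counter-rank j) (var 1F) (var 0F) (row-rank u) (cell-rank u v) acc
      ... | false = vetoedGen-correct ρ i j acc

  items₂Gen-correct : ∀ acc → ⟦ items₂Gen ⟧ᵍ (input ∷ []) acc ≡ emits items₂ acc
  items₂Gen-correct = overSuffixes-listFor encodeItem k _ _ λ j →
    overSuffixes-listFrom encodeItem j _ _ λ i →
    overSuffixes-listFor encodeItem n _ _ λ u →
    overRow u _ λ v →
    candidateGen-correct (cell u v ∷ row u ∷ counter i ∷ counter j ∷ input ∷ []) (var 2F) (var 3F)
      (counter-rank i) (counter-rank j) (var 1F) (var 0F) (row-rank u) (cell-rank u v)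

  guardsGen-correct : ∀ acc → ⟦ guardsGen ⟧ᵍ (input ∷ []) acc ≡ emits guards acc
  guardsGen-correct = overSuffixes-listFor encodeItem k _ _ λ i →
    overSuffixes-listFor encodeItem k _ _ λ j acc →
    let ρ = counter j ∷ counter i ∷ input ∷ []; n≡ = len-tuple n _ in
    trans (guard₁Gen-correct ρ (var 1F) (var 0F) (counter-rank i) (counter-rank j) (hd (var 2F)) n≡ _)
      (cong (encodeItem (guard₁ i j) ∙_)
        (guard₂Gen-correct ρ (var 1F) (var 0F) (counter-rank i) (counter-rank j) (hd (var 2F)) n≡ acc))

  testsGen-correct : ∀ acc → ⟦ testsGen ⟧ᵍ (input ∷ []) acc ≡ emits tests acc
  testsGen-correct = overSuffixes-listFor encodeItem k _ _ λ i →
    overSuffixes-listFor encodeItem k _ _ λ j →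
    overSuffixes-listFor encodeItem k _ _ λ l →
    overSuffixes-listFor encodeItem n _ _ λ s acc →
    let ρ = row s ∷ counter l ∷ counter j ∷ counter i ∷ input ∷ [] in
    trans (test₁Gen-correct ρ (var 3F) (var 2F) (counter-rank i) (counter-rank j) (var 1F) (var 0F) (counter-rank l) (row-rank s) _)
      (cong (encodeItem (test₁ i j l s) ∙_)
        (test₂Gen-correct ρ (var 3F) (var 2F) (counter-rank i) (counter-rank j) (var 1F) (var 0F) (counter-rank l) (row-rank s) acc))

  emits-items : ∀ acc → emits items acc ≡ emits tests (emits guards (emits items₂ (emits items₁ acc)))
  emits-items acc = begin
    emits items acc
      ≡⟨ prepend-++ encodeItem tests _ acc ⟩
    emits tests (emits (guards ++ items₂ ++ items₁) acc)
      ≡⟨ cong (emits tests) (prepend-++ encodeItem guards _ acc) ⟩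
    emits tests (emits guards (emits (items₂ ++ items₁) acc))
      ≡⟨ cong (emits tests ∘ emits guards) (prepend-++ encodeItem items₂ items₁ acc) ⟩
    emits tests (emits guards (emits items₂ (emits items₁ acc)))    ∎
    where open ≡-Reasoning

  itemsGen-correct : ⟦ items₁Gen ⨾ items₂Gen ⨾ guardsGen ⨾ testsGen ⟧ᵍ (input ∷ []) nil ≡ encodeRepresentation representation
  itemsGen-correct = begin
    ⟦ testsGen ⟧ᵍ ρ (⟦ guardsGen ⟧ᵍ ρ (⟦ items₂Gen ⟧ᵍ ρ (⟦ items₁Gen ⟧ᵍ ρ nil)))
      ≡⟨ testsGen-correct _ ⟩
    emits tests (⟦ guardsGen ⟧ᵍ ρ (⟦ items₂Gen ⟧ᵍ ρ (⟦ items₁Gen ⟧ᵍ ρ nil)))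
      ≡⟨ cong (emits tests) (guardsGen-correct _) ⟩
    emits tests (emits guards (⟦ items₂Gen ⟧ᵍ ρ (⟦ items₁Gen ⟧ᵍ ρ nil)))
      ≡⟨ cong (emits tests ∘ emits guards) (items₂Gen-correct _) ⟩
    emits tests (emits guards (emits items₂ (⟦ items₁Gen ⟧ᵍ ρ nil)))
      ≡⟨ cong (emits tests ∘ emits guards ∘ emits items₂) (items₁Gen-correct nil) ⟩
    emits tests (emits guards (emits items₂ (emits items₁ nil)))                   ≡⟨ emits-items nil ⟨
    emits items nil
      ≡⟨ encodeVec-fromList (encodeVec encodeℚᵘ) interval items ⟨
    encodeRepresentation representation                                            ∎
    where
    open ≡-Reasoning
    ρ = input ∷ []

  reductionGen-correct : ⟦ reductionGen ⟧ᵍ (input ∷ []) nil ≡ encodeRepresentation representation ∙ unary (k * k)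
  reductionGen-correct = cong₂ _∙_ itemsGen-correct (begin
    overSuffixes counters (λ t → ⟦ for (tl (var 1F)) (emit nil) ⟧ᵍ (t ∷ input ∷ [])) nil
      ≡⟨ overSuffixes-nils (λ t acc → trans (emitLen-nils (tl (var 1F)) (t ∷ input ∷ []) acc)
           (cong (λ l → nils l acc) (len-tuple k _))) counters nil ⟩
    nils (len counters * k) nil
      ≡⟨ trans (nils-nil _) (cong (λ l → unary (l * k)) (len-tuple k _)) ⟩
    unary (k * k) ∎)
    where open ≡-Reasoning

encodeGraph-rows : ∀ G → let open InputGraph G in
  encodeGraph G ≡ tuple order (λ u → tuple order (λ v → encodeBool (matrix u v)))
encodeGraph-rows G = trans (encodeVec-tabulate (encodeVec encodeBool) order _)
  (tuple-cong order (λ u → encodeVec-tabulate encodeBool order (matrix u)))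
  where open InputGraph G

-- Hardness of both problems

module _ (Π : GraphProperty)
  (dominatingClique⇒Π : ∀ {H : Graph} {k : ℕ} → HasDominatingClique H k → Π H k)
  (Π⇒dominating : ∀ {H : Graph} {k : ℕ} → Π H k → ∃[ D ] ∣ D ∣ ≡ k × IsDominating H D) where

  -- One reduction serves every property lying between having a dominating clique and having a
  -- dominating set of the given size, because on the constructed graphs these two extremes are
  -- equivalent.
  hardness : W[1]-Hard (onUnit3TrackIntervalGraphs Π)
  hardness = reduction k-Clique (onUnit3TrackIntervalGraphs Π) reductionGen (λ k → k * k) 1 2 square≤
    (λ G k → Construction.representation k (InputGraph.order G) (InputGraph.matrix G))
    (λ G k → trans (cong₂ (λ s t → ⟦ reductionGen ⟧ᵍ ((s ∙ t) ∷ []) nil) (encodeGraph-rows G) (unary-tuple k))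
      (reductionGen-correct k (InputGraph.order G) (InputGraph.matrix G)))
    (λ G k → mk⇔ (λ C → dominatingClique⇒Π (clique⇒dominatingClique G k C))
                 (λ p → let _ , ∣D∣≡ , D-dominating = Π⇒dominating p in dominating⇒clique G k ∣D∣≡ D-dominating))
    where
    square≤ : ∀ k → k * k ≤ suc k ^ 2 * 1
    square≤ k = begin
      k * k                  ≤⟨ *-mono-≤ (n≤1+n k) (n≤1+n k) ⟩
      suc k * suc k          ≡⟨ cong (suc k *_) (*-identityʳ (suc k)) ⟨
      suc k ^ 2              ≡⟨ *-identityʳ (suc k ^ 2) ⟨
      suc k ^ 2 * 1          ∎
      where open ≤-Reasoning

theorem5 :
  W[1]-Hard (onUnit3TrackIntervalGraphs HasConnectedDominatingSet) ×
  W[1]-Hard (onUnit3TrackIntervalGraphs HasDominatingClique)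
theorem5 =
  hardness HasConnectedDominatingSet
    (λ {H} (D , ∣D∣≡ , dominating , clique) → D , ∣D∣≡ , dominating , clique⇒connected H clique)
    (λ (D , ∣D∣≡ , dominating , _) → D , ∣D∣≡ , dominating) ,
  hardness HasDominatingClique (λ p → p) (λ (D , ∣D∣≡ , dominating , _) → D , ∣D∣≡ , dominating)
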